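{- Let $S$ be a connected graph with at least three vertices and $S\neq P_3$. Then the statement "every connected claw-$o_{ -1}$-heavy $S$-free graph is traceable" holds if and only if $S\in\{C_3,Z_1,P_4\}$.
   Context: All graphs are finite and simple; $d(v)$ is the degree of $v$ in $G$. $P_i$ is the path on $i$ vertices, $C_3$ the triangle, $Z_1$ the graph obtained from a triangle by attaching one pendant vertex to one of its vertices, and a claw is $K_{1,3}$. A graph $G$ on $n$ vertices is claw-$o_{ -1}$-heavy if every induced subgraph of $G$ isomorphic to $K_{1,3}$ contains two nonadjacent vertices whose degree sum in $G$ is at least $n-1$. $G$ is $S$-free if it has no induced subgraph isomorphic to $S$. Traceable means having a path through all vertices. -}

module Defs where

open import Data.Bool using (Bool; true; false; if_then_else_; _≟_)
open import Data.Nat using (ℕ; zero; suc; _+_; _≤_)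
open import Data.Fin using (Fin; zero; suc)
open import Data.Fin.Properties using (all?)
open import Data.List using (List; map; allFin)
open import Data.Nat.ListAction using (sum)
open import Data.List.Relation.Unary.Linked using (Linked)
open import Data.List.Relation.Unary.Unique.Propositional using (Unique)
open import Data.List.Membership.Propositional using (_∈_)
open import Data.Product using (Σ; ∃; _×_; _,_)
open import Data.Unit using (tt)
open import Function.Definitions using (Injective)
open import Relation.Binary.PropositionalEquality using (_≡_; _≢_)
open import Relation.Nullary using (¬_)
open import Relation.Nullary.Decidable using (toWitness)

record Graph (n : ℕ) : Set where
  field
    adj    : Fin n → Fin n → Bool
    sym    : ∀ i j → adj i j ≡ adj j i
    irrefl : ∀ i → adj i i ≡ false
open Graph public

deg : ∀ {n} → Graph n → Fin n → ℕ
deg {n} G v = sum (map (λ w → if adj G v w then 1 else 0) (allFin n))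

data Reach {n} (G : Graph n) : Fin n → Fin n → Set where
  here : ∀ {u} → Reach G u u
  step : ∀ {u v w} → adj G u v ≡ true → Reach G v w → Reach G u w

Connected : ∀ {n} → Graph n → Set
Connected G = ∀ u v → Reach G u v

Traceable : ∀ {n} → Graph n → Set
Traceable {n} G =
  Σ (List (Fin n)) λ p →
    Linked (λ u v → adj G u v ≡ true) p × Unique p × (∀ v → v ∈ p)

InducedEmb : ∀ {k n} → Graph k → Graph n → (Fin k → Fin n) → Set
InducedEmb H G f = Injective _≡_ _≡_ f × (∀ i j → adj G (f i) (f j) ≡ adj H i j)

Free : ∀ {k n} → Graph k → Graph n → Set
Free H G = ¬ (∃ λ f → InducedEmb H G f)

Iso : ∀ {k m} → Graph k → Graph m → Set
Iso H K = Σ (Fin _ → Fin _) λ f → Σ (Fin _ → Fin _) λ g →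
  (∀ i → g (f i) ≡ i) × (∀ j → f (g j) ≡ j) × (∀ i j → adj K (f i) (f j) ≡ adj H i j)

mkGraph : ∀ {n} (a : Fin n → Fin n → Bool)
  → {s : Relation.Nullary.Decidable.True (all? (λ i → all? (λ j → a i j ≟ a j i)))}
  → {r : Relation.Nullary.Decidable.True (all? (λ i → a i i ≟ false))}
  → Graph n
mkGraph a {s} {r} = record
  { adj = a
  ; sym = λ i j → toWitness s i j
  ; irrefl = λ i → toWitness r i }

clawAdj : Fin 4 → Fin 4 → Bool
clawAdj zero zero = false
clawAdj zero (suc _) = true
clawAdj (suc _) zero = true
clawAdj (suc _) (suc _) = false

Claw : Graph 4
Claw = mkGraph clawAdj

p3Adj : Fin 3 → Fin 3 → Bool
p3Adj zero (suc zero) = true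
p3Adj (suc zero) zero = true
p3Adj (suc zero) (suc (suc zero)) = true
p3Adj (suc (suc zero)) (suc zero) = true
p3Adj _ _ = false

P3 : Graph 3
P3 = mkGraph p3Adj

p4Adj : Fin 4 → Fin 4 → Bool
p4Adj zero (suc zero) = true
p4Adj (suc zero) zero = true
p4Adj (suc zero) (suc (suc zero)) = true
p4Adj (suc (suc zero)) (suc zero) = true
p4Adj (suc (suc zero)) (suc (suc (suc zero))) = true
p4Adj (suc (suc (suc zero))) (suc (suc zero)) = true
p4Adj _ _ = false

P4 : Graph 4
P4 = mkGraph p4Adj

c3Adj : Fin 3 → Fin 3 → Bool
c3Adj zero zero = false
c3Adj (suc zero) (suc zero) = false
c3Adj (suc (suc zero)) (suc (suc zero)) = false
c3Adj _ _ = true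

C3 : Graph 3
C3 = mkGraph c3Adj

z1Adj : Fin 4 → Fin 4 → Bool
z1Adj zero (suc zero) = true
z1Adj zero (suc (suc zero)) = true
z1Adj zero (suc (suc (suc zero))) = true
z1Adj (suc zero) zero = true
z1Adj (suc zero) (suc (suc zero)) = true
z1Adj (suc (suc zero)) zero = true
z1Adj (suc (suc zero)) (suc zero) = true
z1Adj (suc (suc (suc zero))) zero = true
z1Adj _ _ = false

Z1 : Graph 4
Z1 = mkGraph z1Adj

-- Claw-o_{-1}-heavy: every induced claw contains two distinct nonadjacent
-- vertices x, y with d(x) + d(y) ≥ n - 1 (written n ≤ d(x) + d(y) + 1).
ClawO-1Heavy : ∀ {n} → Graph n → Set
ClawO-1Heavy {n} G =
  ∀ f → InducedEmb Claw G f →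
    ∃ λ i → ∃ λ j → i ≢ j × adj G (f i) (f j) ≡ false × n ≤ deg G (f i) + deg G (f j) + 1

{-# OPTIONS --safe #-}

-- Call u ≈ v an edge or a heavy pair (degree sum at least n - 1). As in Ore's theorem, a path with
-- steps in ≈ can be rearranged into a path of G that is at least as long, so a longest path P of G
-- is longest among ≈-paths too. If P, from a to b, misses a vertex, some w outside P is adjacent to
-- an inner vertex x of P, with neighbours y and z on P. Rerouting shows that no two of w, a, b are
-- related by ≈, nor w, y, b or w, z, a, whereas y ≈ z.
-- P4: in a connected P4-free graph w, a, b have a common neighbour, the centre of a light claw.
-- Z1 (and hence C3): y, z is a heavy pair whose common neighbours all lie on P. One of them, s, has
-- degree at least (n - 1)/2, and counting at s shows that y and z have the same neighbours up to a
-- and b, so they have too many of them on P.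
-- Conversely, S is an induced subgraph of the net, which is claw-free and not traceable,
-- and S does not contain the bull, by a bull-free example on nine vertices.
module Submission where

open import Defs
import Algebra.Solver.CommutativeMonoid as CommutativeMonoidSolver
open import Data.Bool using (Bool; true; false; if_then_else_; _∧_; _∨_)
open import Data.Bool.ListAction using (any)
import Data.Bool.Properties as Bool
open import Data.Empty using (⊥; ⊥-elim)
open import Data.Fin using (Fin; zero; suc; toℕ; inject₁)
open import Data.Fin.Patterns using (0F; 1F; 2F; 3F; 4F; 5F; 6F; 7F; 8F)
import Data.Fin.Properties as Fin
open import Data.Fin.Subset using (Subset; ∣_∣)
open import Data.Fin.Subset.Properties using (anySubset?)
open import Data.List using (List; []; _∷_; _++_; map; length; allFin; reverse)
open import Data.List.Properties using (length-++; length-tabulate; length-reverse; unfold-reverse; map-++; ++-assoc)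
open import Data.List.Membership.Propositional using (_∈_; _∉_)
open import Data.List.Membership.Propositional.Properties using (∈-∃++; ∈-allFin; ∈-++⁺ˡ; ∈-++⁺ʳ; ∈-++⁻)
open import Data.List.Membership.DecPropositional using () renaming (_∈?_ to member?)
import Data.List.Relation.Unary.All as All
import Data.List.Relation.Unary.All.Properties as All
open import Data.List.Relation.Unary.All using ([]; _∷_)
import Data.List.Relation.Unary.AllPairs as AllPairs
open import Data.List.Relation.Unary.AllPairs using ([]; _∷_)
open import Data.List.Relation.Unary.Any using (here; there)
open import Data.List.Relation.Unary.Linked using (Linked; []; [-]; _∷_; linked?)
open import Data.List.Relation.Unary.Unique.DecPropositional using (unique?)
open import Data.List.Relation.Unary.Unique.Propositional using (Unique)
open import Data.List.Relation.Unary.Unique.Propositional.Properties using (Unique[x∷xs]⇒x∉xs; allFin⁺)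
open import Data.List.Relation.Binary.Permutation.Propositional
  using (_↭_; ↭-refl; ↭-sym; ↭-trans; prep; ↭⇒↭ₛ)
open import Data.List.Relation.Binary.Permutation.Propositional.Properties
  using (shift; ↭-length; ↭-reverse; map⁺; ∈-resp-↭; ++⁺; ++⁺ˡ; ++⁺ʳ; ++-comm; ++-commutativeMonoid)
import Data.List.Relation.Binary.Permutation.Setoid.Properties as PermS
open import Data.Nat using (ℕ; zero; suc; _+_; _*_; _≤_; _<_; z≤n; s≤s; _≡ᵇ_)
open import Data.Nat.Properties
open import Data.Nat.ListAction using (sum)
open import Data.Nat.ListAction.Properties using (sum-++; sum-↭)
open import Data.Nat.Tactic.RingSolver using (solve-∀)
open import Data.Product using (∃; ∃-syntax; _×_; _,_; proj₁; proj₂)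
open import Data.Sum using (_⊎_; inj₁; inj₂; [_,_]′)
open import Data.Unit using (tt)
open import Data.Vec using (Vec; []; _∷_; toList; fromList; lookup; tabulate)
open import Data.Vec.Properties using (toList∘fromList; lookup∘tabulate; length-toList)
open import Function using (_∘_; id; case_of_)
open import Function.Bundles using (_⇔_; mk⇔)
open import Relation.Binary.PropositionalEquality
  using (_≡_; _≢_; refl; trans; cong; cong₂; subst; setoid; ≢-sym) renaming (sym to ≡-sym)
open import Relation.Nullary using (¬_; Dec; yes; no; contradiction; ¬?)
open import Relation.Nullary.Decidable
  using (_⊎-dec_; _×-dec_; _→-dec_; decidable-stable; map′; toWitness; does; dec-true)

-- Arithmetic, lists without repetition, and counting over the vertices

≤-absurd : ∀ {a b} k → a ≤ b → a ≡ b + suc k → ⊥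
≤-absurd {a} {b} k a≤b a≡b+1+k =
  <-irrefl refl (≤-trans (subst (suc b ≤_) (≡-sym a≡b+1+k) b<) a≤b)
  where
  b< : suc b ≤ b + suc k
  b< = subst (suc b ≤_) (≡-sym (+-suc b k)) (s≤s (m≤m+n b k))

-- Counting arguments add up inequalities. The ring solver then exhibits a common summand `k`,
-- cancelled here, or, for `≤-absurd`, a left side exceeding the right one.
≤-cancel : ∀ {a b c d} k → a ≤ b → a ≡ c + k → b ≡ d + k → c ≤ d
≤-cancel {c = c} {d} k a≤b refl refl = +-cancelʳ-≤ k c d a≤b

module _ {A : Set} where

  Unique-resp-↭ : {xs ys : List A} → xs ↭ ys → Unique xs → Unique ys
  Unique-resp-↭ p = PermS.Unique-resp-↭ (setoid A) (↭⇒↭ₛ p)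

  Unique-∷ : {x : A} {xs : List A} → x ∉ xs → Unique xs → Unique (x ∷ xs)
  Unique-∷ x∉xs u = All.¬Any⇒All¬ _ x∉xs ∷ u

  Unique-++⇒≢ : ∀ (xs : List A) {ys x y} → Unique (xs ++ ys) → x ∈ xs → y ∈ ys → x ≢ y
  Unique-++⇒≢ (x ∷ xs) u (here refl) y∈ refl = Unique[x∷xs]⇒x∉xs u (∈-++⁺ʳ xs y∈)
  Unique-++⇒≢ (x ∷ xs) (_ ∷ u) (there x∈) y∈ = Unique-++⇒≢ xs u x∈ y∈

  Unique-++⇒ˡ : ∀ (xs : List A) {ys} → Unique (xs ++ ys) → Unique xs
  Unique-++⇒ˡ [] u = []
  Unique-++⇒ˡ (x ∷ xs) (x∉ ∷ u) = All.++⁻ˡ xs x∉ ∷ Unique-++⇒ˡ xs u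

  complement : {xs ys : List A} → Unique xs → (∀ {x} → x ∈ xs → x ∈ ys) → ∃[ r ] ys ↭ xs ++ r
  complement {[]} {ys} _ _ = ys , ↭-refl
  complement {x ∷ xs} (x∉xs ∷ u) xs⊆ys with ∈-∃++ (xs⊆ys (here refl))
  ... | as , bs , refl with complement {xs} {as ++ bs} u xs⊆
    where
    xs⊆ : ∀ {z} → z ∈ xs → z ∈ as ++ bs
    xs⊆ z∈ with ∈-resp-↭ (shift x as bs) (xs⊆ys (there z∈))
    ... | here refl = contradiction refl (All.lookup x∉xs z∈)
    ... | there z∈′ = z∈′
  ... | r , p = r , ↭-trans (shift x as bs) (prep x p)

  sum-map-+ : ∀ (f g : A → ℕ) xs →
    sum (map (λ v → f v + g v) xs) ≡ sum (map f xs) + sum (map g xs)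
  sum-map-+ f g [] = refl
  sum-map-+ f g (x ∷ xs) = trans (cong (f x + g x +_) (sum-map-+ f g xs)) (eq (f x) (g x) _ _)
    where
    eq : ∀ a b c d → a + b + (c + d) ≡ a + c + (b + d)
    eq = solve-∀

⟦_⟧ : Bool → ℕ
⟦ b ⟧ = if b then 1 else 0

⟦⟧≤1 : ∀ b → ⟦ b ⟧ ≤ 1
⟦⟧≤1 true = ≤-refl
⟦⟧≤1 false = z≤n

module _ {n : ℕ} where

  infix 4 _∈?_
  _∈?_ : (v : Fin n) (xs : List (Fin n)) → Dec (v ∈ xs)
  _∈?_ = member? Fin._≟_

  ∑ : (Fin n → ℕ) → ℕ
  ∑ f = sum (map f (allFin n))

  Unique⇒complement : {l : List (Fin n)} → Unique l → ∃[ r ] allFin n ↭ l ++ r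
  Unique⇒complement u = complement u (λ _ → ∈-allFin _)

  length-allFin : length (allFin n) ≡ n
  length-allFin = length-tabulate id

  Unique-length : {l : List (Fin n)} → Unique l → length l ≤ n
  Unique-length {l} u with Unique⇒complement u
  ... | r , p = ≤-trans (m≤m+n (length l) (length r))
    (≤-reflexive (trans (≡-sym (length-++ l)) (trans (≡-sym (↭-length p)) length-allFin)))

  Unique-allFin : Unique (allFin n)
  Unique-allFin = allFin⁺ n

  -- The second alternative is ∑ f ≤ Σ_l f + (n - |l|) c, stated without subtraction.
  excess : ∀ (f : Fin n → ℕ) c {l} → Unique l →
    (∃[ v ] v ∉ l × c < f v) ⊎ (∑ f + length l * c ≤ sum (map f l) + n * c)
  excess f c {l} u with Unique⇒complement u
  ... | r , p = case scan r (λ v∈r v∈l → Unique-++⇒≢ l uniq v∈l v∈r refl) of λ where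
      (inj₁ big) → inj₁ big
      (inj₂ r≤) → inj₂ (≤-cancel 0
        (+-monoʳ-≤ (sum (map f l)) (+-monoˡ-≤ (length l * c) r≤))
        (trans (≡-sym (trans (cong (_+ length l * c) ∑≡) (+-assoc (sum (map f l)) _ _))) (≡-sym (+-identityʳ _)))
        (trans (cong (sum (map f l) +_) n≡) (≡-sym (+-identityʳ _))))
    where
    uniq : Unique (l ++ r)
    uniq = Unique-resp-↭ p Unique-allFin
    ∑≡ : ∑ f ≡ sum (map f l) + sum (map f r)
    ∑≡ = trans (sum-↭ (map⁺ f p)) (trans (cong sum (map-++ f l r)) (sum-++ (map f l) (map f r)))
    n≡ : length r * c + length l * c ≡ n * c
    n≡ = trans (≡-sym (*-distribʳ-+ c (length r) (length l)))
      (cong (_* c) (trans (+-comm (length r) (length l))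
        (trans (≡-sym (length-++ l)) (trans (≡-sym (↭-length p)) length-allFin))))
    scan : ∀ r → (∀ {v} → v ∈ r → v ∉ l) → (∃[ v ] v ∉ l × c < f v) ⊎ (sum (map f r) ≤ length r * c)
    scan [] _ = inj₂ z≤n
    scan (v ∷ r) r∉ with f v ≤? c | scan r (r∉ ∘ there)
    ... | no fv≰c | _ = inj₁ (v , r∉ (here refl) , ≰⇒> fv≰c)
    ... | yes _ | inj₁ big = inj₁ big
    ... | yes fv≤c | inj₂ r≤ = inj₂ (+-mono-≤ fv≤c r≤)

  ∑-supported : ∀ (f : Fin n → ℕ) {l} → Unique l → (∀ {v} → v ∉ l → ¬ (0 < f v)) → ∑ f ≤ sum (map f l)
  ∑-supported f {l} u f≯0 with excess f 0 u
  ... | inj₁ (v , v∉l , fv>0) = contradiction fv>0 (f≯0 v∉l)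
  ... | inj₂ h = ≤-cancel 0 h (cong (∑ f +_) (*-zeroʳ (length l))) (cong (sum (map f l) +_) (*-zeroʳ n))

-- Paths with their ends and vertex lists

infixr 5 _∷_
-- The ends and the vertex list are indices, so that joining and reversing paths computes the list,
-- and reroutings reduce to permutations of it.
data Path {A : Set} (R : A → A → Set) : A → List A → A → Set where
  [_] : ∀ a → Path R a (a ∷ []) a
  _∷_ : ∀ {a b l c} → R a b → Path R b l c → Path R a (a ∷ l) c

module _ {A : Set} {R : A → A → Set} where

  infixr 5 _++⟨_⟩_
  _++⟨_⟩_ : ∀ {a l b c l′ d} → Path R a l b → R b c → Path R c l′ d → Path R a (l ++ l′) d
  [ _ ] ++⟨ r ⟩ q = r ∷ q
  (s ∷ p) ++⟨ r ⟩ q = s ∷ (p ++⟨ r ⟩ q)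

  rev : (∀ {a b} → R a b → R b a) → ∀ {a l b} → Path R a l b → Path R b (reverse l) a
  rev R-sym [ a ] = [ a ]
  rev R-sym {a} {_} {b} (_∷_ {l = l} r p) =
    subst (λ l → Path R b l a) (≡-sym (unfold-reverse a l)) (rev R-sym p ++⟨ R-sym r ⟩ [ a ])

  first∈ : ∀ {a l b} → Path R a l b → a ∈ l
  first∈ [ a ] = here refl
  first∈ (_ ∷ _) = here refl

  last∈ : ∀ {a l b} → Path R a l b → b ∈ l
  last∈ [ a ] = here refl
  last∈ (_ ∷ p) = there (last∈ p)

  unsnoc : ∀ {a l b} → Path R a l b →
    (l ≡ a ∷ [] × a ≡ b) ⊎ (∃[ l′ ] ∃[ c ] l ≡ l′ ++ b ∷ [] × Path R a l′ c × R c b)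
  unsnoc [ a ] = inj₁ (refl , refl)
  unsnoc (_∷_ {a} r p) with unsnoc p
  ... | inj₁ (refl , refl) = inj₂ (a ∷ [] , a , refl , [ a ] , r)
  ... | inj₂ (l′ , c , refl , p′ , s) = inj₂ (a ∷ l′ , c , refl , r ∷ p′ , s)

  record Interior (a : A) (l : List A) (b v : A) : Set where
    constructor interior
    field
      {pre} {post} : List A
      {prev next}  : A
      split        : l ≡ pre ++ v ∷ post
      left         : Path R a pre prev
      into         : R prev v
      out          : R v next
      right        : Path R next post b

  locate : ∀ {a l b v} → Path R a l b → v ∈ l → v ≡ a ⊎ v ≡ b ⊎ Interior a l b v
  locate [ a ] (here refl) = inj₁ refl
  locate (r ∷ p) (here refl) = inj₁ refl
  locate {a} (r ∷ p) (there v∈) with locate p v∈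
  ... | inj₂ (inj₁ v≡b) = inj₂ (inj₁ v≡b)
  ... | inj₂ (inj₂ (interior l≡ p₁ i o p₂)) = inj₂ (inj₂ (interior (cong (a ∷_) l≡) (r ∷ p₁) i o p₂))
  locate {a} (r ∷ [ b ]) (there v∈) | inj₁ refl = inj₂ (inj₁ refl)
  locate {a} (r ∷ s ∷ p) (there v∈) | inj₁ refl = inj₂ (inj₂ (interior refl [ a ] r s p))

  record Crossing (α β : A → Bool) (a : A) (l : List A) (b : A) : Set where
    constructor crossing
    field
      {pre post}  : List A
      {prev next} : A
      split       : l ≡ pre ++ post
      left        : Path R a pre prev
      edge        : R prev next
      right       : Path R next post b
      α-prev      : α prev ≡ true
      β-next      : β next ≡ true

  -- Without a crossing, each edge u v of the path contributes at most 1 to α u + β v.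
  cross : ∀ (α β : A → Bool) {a l b} → Path R a l b →
    Crossing α β a l b ⊎ (sum (map (λ v → ⟦ α v ⟧ + ⟦ β v ⟧) l) + 1 ≤ ⟦ β a ⟧ + length l + ⟦ α b ⟧)
  cross α β [ a ] = inj₂ (≤-reflexive (eq ⟦ α a ⟧ ⟦ β a ⟧))
    where
    eq : ∀ x y → x + y + 0 + 1 ≡ y + 1 + x
    eq = solve-∀
  cross α β (_∷_ {a} {b} {l} {c} r p) with α a in αa | β b in βb | cross α β p
  ... | true  | true  | _ = inj₁ (crossing refl [ a ] r p αa βb)
  ... | _ | _ | inj₁ (crossing refl p₁ e p₂ x y) = inj₁ (crossing refl (r ∷ p₁) e p₂ x y)
  ... | true  | false | inj₂ h = inj₂ (≤-cancel 0 (+-monoʳ-≤ (1 + ⟦ β a ⟧) h) (eq₁ ⟦ β a ⟧ _) (eq₂ ⟦ β a ⟧ _ _))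
    where
    eq₁ : ∀ x s → 1 + x + (s + 1) ≡ (1 + x + s + 1) + 0
    eq₁ = solve-∀
    eq₂ : ∀ x s t → 1 + x + (0 + s + t) ≡ (x + suc s + t) + 0
    eq₂ = solve-∀
  ... | false | true  | inj₂ h = inj₂ (≤-cancel 0 (+-monoʳ-≤ ⟦ β a ⟧ h) (eq₁ ⟦ β a ⟧ _) (eq₂ ⟦ β a ⟧ _ _))
    where
    eq₁ : ∀ x s → x + (s + 1) ≡ (x + s + 1) + 0
    eq₁ = solve-∀
    eq₂ : ∀ x s t → x + (1 + s + t) ≡ (x + suc s + t) + 0
    eq₂ = solve-∀
  ... | false | false | inj₂ h = inj₂ (≤-trans (≤-reflexive (+-assoc ⟦ β a ⟧ _ 1))
    (≤-trans (+-monoʳ-≤ ⟦ β a ⟧ h)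
      (≤-cancel 0 (n≤1+n (⟦ β a ⟧ + length l + ⟦ α c ⟧)) (eq₁ ⟦ β a ⟧ _ _) (eq₂ ⟦ β a ⟧ _ _))))
    where
    eq₁ : ∀ x s t → x + s + t ≡ (x + (0 + s + t)) + 0
    eq₁ = solve-∀
    eq₂ : ∀ x s t → suc (x + s + t) ≡ (x + suc s + t) + 0
    eq₂ = solve-∀

-- Ore-type rearrangement of paths with heavy steps

module Adjacency {n : ℕ} (G : Graph n) where

  module ↭-Solver = CommutativeMonoidSolver (++-commutativeMonoid {A = Fin n})
  open ↭-Solver using (_⊕_; _⊜_)

  infix 4 _~_ _≈_ _≈?_ _~?_
  _~_ : Fin n → Fin n → Set
  u ~ v = adj G u v ≡ true

  Heavy : Fin n → Fin n → Set
  Heavy u v = n ≤ deg G u + deg G v + 1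

  _≈_ : Fin n → Fin n → Set
  u ≈ v = u ~ v ⊎ Heavy u v

  _~?_ : ∀ u v → Dec (u ~ v)
  u ~? v = adj G u v Bool.≟ true

  _≈?_ : ∀ u v → Dec (u ≈ v)
  u ≈? v = (u ~? v) ⊎-dec (n ≤? deg G u + deg G v + 1)

  ~-sym : ∀ {u v} → u ~ v → v ~ u
  ~-sym {u} {v} = trans (sym G v u)

  Heavy-sym : ∀ {u v} → Heavy u v → Heavy v u
  Heavy-sym {u} {v} = subst (λ k → n ≤ k + 1) (+-comm (deg G u) (deg G v))

  ≈-sym : ∀ {u v} → u ≈ v → v ≈ u
  ≈-sym (inj₁ u~v) = inj₁ (~-sym u~v)
  ≈-sym {u} {v} (inj₂ h) = inj₂ (Heavy-sym {u} {v} h)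

  ~⇒≢ : ∀ {u v} → u ~ v → u ≢ v
  ~⇒≢ {u} u~u refl with trans (≡-sym u~u) (irrefl G _)
  ... | ()

  ≁⇒≡false : ∀ {u v} → ¬ (u ~ v) → adj G u v ≡ false
  ≁⇒≡false = Bool.¬-not

  path-≈ : ∀ {a l b} → Path _~_ a l b → Path _≈_ a l b
  path-≈ [ a ] = [ a ]
  path-≈ (r ∷ p) = inj₁ r ∷ path-≈ p

  -- Summed over all vertices this is d(y) + d(z). With `y` and `z` equal it is twice the indicator
  -- of adjacency, a form used for doubled degrees.
  joint : Fin n → Fin n → Fin n → ℕ
  joint y z v = ⟦ adj G y v ⟧ + ⟦ adj G z v ⟧

  ∑-joint : ∀ y z → ∑ (joint y z) ≡ deg G y + deg G z
  ∑-joint y z = sum-map-+ _ _ (allFin n)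

  ≁⇒⟦⟧≡0 : ∀ {u v} → ¬ (u ~ v) → ⟦ adj G u v ⟧ ≡ 0
  ≁⇒⟦⟧≡0 u≁v = cong ⟦_⟧ (≁⇒≡false u≁v)

  ~⇒⟦⟧≡1 : ∀ {u v} → u ~ v → ⟦ adj G u v ⟧ ≡ 1
  ~⇒⟦⟧≡1 u~v = cong ⟦_⟧ u~v

  joint>1 : ∀ {y z v} → 1 < joint y z v → y ~ v × z ~ v
  joint>1 {y} {z} {v} h with adj G y v in p | adj G z v in q
  ... | true  | true  = refl , refl
  ... | true  | false = contradiction h (<-irrefl refl)
  ... | false | true  = contradiction h (<-irrefl refl)
  ... | false | false = contradiction h (λ ())

  AtLeast : ℕ → Set
  AtLeast k = ∃[ a ] ∃[ l ] ∃[ b ] Path _~_ a l b × Unique l × k ≤ length l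

  private
    -- A path L of G that is followed by a heavy step y z can be rearranged so that an edge leaves L instead,
    -- because the vertex set of a path without a neighbour of both y and z outside it carries
    -- at most |L ++ R| - 2 edges at y and z if neither an end nor a crossing is available.
    repair : ∀ k {a L y z R b} → n ≤ length L + k →
      Path _~_ a L y → y ≈ z → Path _≈_ z R b → Unique (L ++ R) → AtLeast (length (L ++ R))
    -- The edge moves `z` into the part that is already a path of `G`, so `k`, which bounds the
    -- number of vertices outside that part, drops by one. The separate bound `v` allows for a
    -- vertex inserted just before.
    extend : ∀ k {a l y z R b v} → n ≤ length l + suc k →
      Path _~_ a l y → y ~ z → Path _≈_ z R b → Unique (l ++ R) → v ≤ length (l ++ R) → AtLeast v

    -- Without fuel `L` would already have `n` vertices, although `z` is still to come.
    repair zero {L = L} {R = R} n≤ p _ q u = ⊥-elim (<-irrefl refl (≤-trans (s≤s n≤L) (≤-trans L<LR (Unique-length u))))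
      where
      n≤L : n ≤ length L
      n≤L = subst (n ≤_) (+-identityʳ _) n≤
      0<R : ∀ {z R b} → Path _≈_ z R b → 0 < length R
      0<R [ _ ] = s≤s z≤n
      0<R (_ ∷ _) = s≤s z≤n
      L<LR : length L < length (L ++ R)
      L<LR = ≤-trans (≤-reflexive (+-comm 1 (length L)))
        (≤-trans (+-monoʳ-≤ (length L) (0<R q)) (≤-reflexive (≡-sym (length-++ L))))
    repair (suc k) n≤ p (inj₁ y~z) q u = extend k n≤ p y~z q u ≤-refl
    repair (suc k) {a} {L} {y} {z} {R} {b} n≤ p (inj₂ h) q u = go (z ~? a) (y ~? b)
      (cross (adj G y) (adj G z) p) (cross (adj G y) (adj G z) q) (excess (joint y z) 1 u)
      where
      reroute : ∀ {a l y z R′ b} → length L ≤ length l → Path _~_ a l y → y ~ z →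
        Path _≈_ z R′ b → l ++ R′ ↭ L ++ R → AtLeast (length (L ++ R))
      reroute {l = l} l≥ p e q l↭ = extend k (≤-trans n≤ (+-monoˡ-≤ (suc k) l≥))
        p e q (Unique-resp-↭ (↭-sym l↭) u) (≤-reflexive (≡-sym (↭-length l↭)))
      go : Dec (z ~ a) → Dec (y ~ b) →
        Crossing {R = _~_} (adj G y) (adj G z) a L y ⊎ sum (map (joint y z) L) + 1 ≤ ⟦ adj G z a ⟧ + length L + ⟦ adj G y y ⟧ →
        Crossing {R = _≈_} (adj G y) (adj G z) z R b ⊎ sum (map (joint y z) R) + 1 ≤ ⟦ adj G z z ⟧ + length R + ⟦ adj G y b ⟧ →
        (∃[ v ] v ∉ L ++ R × 1 < joint y z v) ⊎ ∑ (joint y z) + length (L ++ R) * 1 ≤ sum (map (joint y z) (L ++ R)) + n * 1 →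
        AtLeast (length (L ++ R))
      go (yes z~a) _ _ _ _ = reroute (≤-reflexive (≡-sym (length-reverse L))) (rev ~-sym p) (~-sym z~a) q (++⁺ʳ R (↭-reverse L))
      go _ (yes y~b) _ _ _ = reroute ≤-refl p y~b (rev ≈-sym q) (++⁺ˡ L (↭-reverse R))
      -- The new order is a .. c, y .. d, z .. b: the part of `L` after the crossing is reversed.
      go _ _ (inj₁ (crossing {l₁} {l₂} refl p₁ _ p₂ y~c z~d)) _ _ =
        reroute (≤-reflexive (≡-sym (↭-length (++⁺ˡ l₁ (↭-reverse l₂))))) (p₁ ++⟨ ~-sym y~c ⟩ rev ~-sym p₂) (~-sym z~d) q
          (++⁺ʳ R (++⁺ˡ l₁ (↭-reverse l₂)))
      -- The new order is a .. y, c .. z, d .. b: the part of `R` before the crossing is reversed.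
      go _ _ _ (inj₁ (crossing {l₁} {l₂} refl q₁ _ q₂ y~c z~d)) _ =
        reroute ≤-refl p y~c (rev ≈-sym q₁ ++⟨ inj₁ z~d ⟩ q₂) (++⁺ˡ L (++⁺ʳ l₂ (↭-reverse l₁)))
      go _ _ _ _ (inj₁ (v , v∉ , v>1)) with joint>1 {y} {z} v>1
      ... | y~v , z~v = extend k n≤ p y~v (inj₁ (~-sym z~v) ∷ q)
        (Unique-resp-↭ (↭-sym (shift v L R)) (Unique-∷ v∉ u))
        (≤-trans (n≤1+n _) (≤-reflexive (≡-sym (↭-length (shift v L R)))))
      go (no z≁a) (no y≁b) (inj₂ hL) (inj₂ hR) (inj₂ hn)
        rewrite ≁⇒⟦⟧≡0 z≁a | ≁⇒⟦⟧≡0 y≁b | irrefl G y | irrefl G z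
          | map-++ (joint y z) L R | sum-++ (map (joint y z) L) (map (joint y z) R)
          | length-++ L {R} | ∑-joint y z =
        ⊥-elim (≤-absurd 0 (+-mono-≤ (+-mono-≤ hL hR) (+-mono-≤ hn h))
          (eq (sum (map (joint y z) L)) (sum (map (joint y z) R)) (length L) (length R) n (deg G y) (deg G z)))
        where
        eq : ∀ s t l r n d e → s + 1 + (t + 1) + (d + e + (l + r) * 1 + n)
          ≡ (l + 0) + (r + 0) + (s + t + n * 1 + (d + e + 1)) + 1
        eq = solve-∀

    extend k n≤ p y~z [ z ] u v≤ = _ , _ , _ , p ++⟨ y~z ⟩ [ z ] , u , v≤
    extend k {l = l} n≤ p y~z (_∷_ {z} {l = R} z≈z′ q) u v≤
      with repair k
        (subst (n ≤_) (trans (≡-sym (+-assoc (length l) 1 k)) (cong (_+ k) (≡-sym (length-++ l)))) n≤)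
        (p ++⟨ y~z ⟩ [ z ]) z≈z′ q (subst Unique (≡-sym (++-assoc l (z ∷ []) R)) u)
    ... | a′ , l′ , b′ , p′ , u′ , l′≥ = a′ , l′ , b′ , p′ , u′ ,
      ≤-trans v≤ (subst (λ xs → length xs ≤ length l′) (++-assoc l (z ∷ []) R) l′≥)

  -- The repair starts with the first vertex alone as a path of `G`.
  straighten : ∀ {a l b} → Path _≈_ a l b → Unique l → AtLeast (length l)
  straighten [ a ] u = a , a ∷ [] , a , [ a ] , u , ≤-refl
  straighten (_∷_ {a} r q) u = repair n (n≤1+n n) [ a ] r q u

-- Induced subgraphs on four vertices

quad : ∀ {A : Set} → A → A → A → A → Fin 4 → A
quad v₀ v₁ v₂ v₃ 0F = v₀
quad v₀ v₁ v₂ v₃ 1F = v₁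
quad v₀ v₁ v₂ v₃ 2F = v₂
quad v₀ v₁ v₂ v₃ 3F = v₃

-- Symmetry and irreflexivity of both graphs leave only the six pairs with i < j to check.
quad-embeds : ∀ (H : Graph 4) {n} (G : Graph n) {v₀ v₁ v₂ v₃} →
  v₀ ≢ v₁ → v₀ ≢ v₂ → v₀ ≢ v₃ → v₁ ≢ v₂ → v₁ ≢ v₃ → v₂ ≢ v₃ →
  adj G v₀ v₁ ≡ adj H 0F 1F → adj G v₀ v₂ ≡ adj H 0F 2F → adj G v₀ v₃ ≡ adj H 0F 3F →
  adj G v₁ v₂ ≡ adj H 1F 2F → adj G v₁ v₃ ≡ adj H 1F 3F → adj G v₂ v₃ ≡ adj H 2F 3F →
  InducedEmb H G (quad v₀ v₁ v₂ v₃)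
quad-embeds H G {v₀} {v₁} {v₂} {v₃} n₀₁ n₀₂ n₀₃ n₁₂ n₁₃ n₂₃ e₀₁ e₀₂ e₀₃ e₁₂ e₁₃ e₂₃ = inj , ind
  where
  f = quad v₀ v₁ v₂ v₃
  inj : ∀ {i j} → f i ≡ f j → i ≡ j
  inj {0F} {0F} _ = refl
  inj {0F} {1F} e = contradiction e n₀₁
  inj {0F} {2F} e = contradiction e n₀₂
  inj {0F} {3F} e = contradiction e n₀₃
  inj {1F} {0F} e = contradiction (≡-sym e) n₀₁
  inj {1F} {1F} _ = refl
  inj {1F} {2F} e = contradiction e n₁₂
  inj {1F} {3F} e = contradiction e n₁₃
  inj {2F} {0F} e = contradiction (≡-sym e) n₀₂
  inj {2F} {1F} e = contradiction (≡-sym e) n₁₂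
  inj {2F} {2F} _ = refl
  inj {2F} {3F} e = contradiction e n₂₃
  inj {3F} {0F} e = contradiction (≡-sym e) n₀₃
  inj {3F} {1F} e = contradiction (≡-sym e) n₁₃
  inj {3F} {2F} e = contradiction (≡-sym e) n₂₃
  inj {3F} {3F} _ = refl
  flip : ∀ {i j} → adj G (f i) (f j) ≡ adj H i j → adj G (f j) (f i) ≡ adj H j i
  flip {i} {j} e = trans (sym G _ _) (trans e (sym H i j))
  diag : ∀ i → adj G (f i) (f i) ≡ adj H i i
  diag i = trans (irrefl G _) (≡-sym (irrefl H i))
  ind : ∀ i j → adj G (f i) (f j) ≡ adj H i j
  ind 0F 0F = diag 0F
  ind 0F 1F = e₀₁
  ind 0F 2F = e₀₂
  ind 0F 3F = e₀₃
  ind 1F 0F = flip {0F} {1F} e₀₁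
  ind 1F 1F = diag 1F
  ind 1F 2F = e₁₂
  ind 1F 3F = e₁₃
  ind 2F 0F = flip {0F} {2F} e₀₂
  ind 2F 1F = flip {1F} {2F} e₁₂
  ind 2F 2F = diag 2F
  ind 2F 3F = e₂₃
  ind 3F 0F = flip {0F} {3F} e₀₃
  ind 3F 1F = flip {1F} {3F} e₁₃
  ind 3F 2F = flip {2F} {3F} e₂₃
  ind 3F 3F = diag 3F

-- Longest paths

module ClawHeavy {n : ℕ} (G : Graph n) (heavy : ClawO-1Heavy G) where

  open Adjacency G
  open ↭-Solver using (_⊕_; _⊜_)

  -- The centre is adjacent to every leaf, so the nonadjacent pair supplied by `heavy` consists of
  -- two leaves.
  claw⇒heavy : ∀ {c p q r} → c ~ p → c ~ q → c ~ r → p ≢ q → p ≢ r → q ≢ r →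
    ¬ (p ~ q) → ¬ (p ~ r) → ¬ (q ~ r) → Heavy p q ⊎ Heavy p r ⊎ Heavy q r
  claw⇒heavy {c} {p} {q} {r} cp cq cr p≢q p≢r q≢r p≁q p≁r q≁r = case heavy (quad c p q r)
    (quad-embeds Claw G (~⇒≢ cp) (~⇒≢ cq) (~⇒≢ cr) p≢q p≢r q≢r cp cq cr
      (≁⇒≡false p≁q) (≁⇒≡false p≁r) (≁⇒≡false q≁r)) of λ where
    (0F , 0F , i≢j , _) → contradiction refl i≢j
    (0F , 1F , _ , e , _) → contradiction (trans (≡-sym cp) e) (λ ())
    (0F , 2F , _ , e , _) → contradiction (trans (≡-sym cq) e) (λ ())
    (0F , 3F , _ , e , _) → contradiction (trans (≡-sym cr) e) (λ ())
    (1F , 0F , _ , e , _) → contradiction (trans (≡-sym (~-sym cp)) e) (λ ())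
    (2F , 0F , _ , e , _) → contradiction (trans (≡-sym (~-sym cq)) e) (λ ())
    (3F , 0F , _ , e , _) → contradiction (trans (≡-sym (~-sym cr)) e) (λ ())
    (1F , 1F , i≢j , _) → contradiction refl i≢j
    (2F , 2F , i≢j , _) → contradiction refl i≢j
    (3F , 3F , i≢j , _) → contradiction refl i≢j
    (1F , 2F , _ , _ , h) → inj₁ h
    (2F , 1F , _ , _ , h) → inj₁ (Heavy-sym {q} {p} h)
    (1F , 3F , _ , _ , h) → inj₂ (inj₁ h)
    (3F , 1F , _ , _ , h) → inj₂ (inj₁ (Heavy-sym {r} {p} h))
    (2F , 3F , _ , _ , h) → inj₂ (inj₂ h)
    (3F , 2F , _ , _ , h) → inj₂ (inj₂ (Heavy-sym {r} {q} h))

  no-light-claw : ∀ {c p q r} → c ~ p → c ~ q → c ~ r → p ≢ q → p ≢ r → q ≢ r →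
    ¬ (p ≈ q) → ¬ (p ≈ r) → ¬ (q ≈ r) → ⊥
  no-light-claw cp cq cr p≢q p≢r q≢r p≉q p≉r q≉r
    with claw⇒heavy cp cq cr p≢q p≢r q≢r (p≉q ∘ inj₁) (p≉r ∘ inj₁) (q≉r ∘ inj₁)
  ... | inj₁ h = p≉q (inj₂ h)
  ... | inj₂ (inj₁ h) = p≉r (inj₂ h)
  ... | inj₂ (inj₂ h) = q≉r (inj₂ h)

  -- Only the length of `l` enters, so the property passes to reversed and rerouted paths of the
  -- same length.
  record Longest (l : List (Fin n)) : Set where
    constructor longest
    field no-longer : ∀ {c k d} → Path _≈_ c k d → Unique k → ¬ (length l < length k)

  open Longest

  no-extension : ∀ {l c k d v} → Longest l → Unique (v ∷ l) → Path _≈_ c k d → k ↭ v ∷ l → ⊥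
  no-extension m u p k↭ = no-longer m p (Unique-resp-↭ (↭-sym k↭) u) (≤-reflexive (≡-sym (↭-length k↭)))

  -- The path L x R, from a through y, x, z to b, is longest, even among paths with heavy steps,
  -- and x has the neighbour w outside it.
  record Attached (a : Fin n) (L : List (Fin n)) (y x z : Fin n) (R : List (Fin n)) (b w : Fin n) : Set where
    field
      left  : Path _~_ a L y
      y~x   : y ~ x
      x~z   : x ~ z
      right : Path _~_ z R b
      x~w   : x ~ w
      fresh : Unique (w ∷ L ++ x ∷ R)
      max   : Longest (L ++ x ∷ R)

    left≈ : Path _≈_ a L y
    left≈ = path-≈ left

    right≈ : Path _≈_ z R b
    right≈ = path-≈ right

    extension : ∀ {c k d} → Path _≈_ c k d → k ↭ w ∷ L ++ x ∷ R → ⊥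
    extension = no-extension max fresh

    unique : Unique (L ++ x ∷ R)
    unique = AllPairs.tail fresh

    left-right : ∀ {u v} → u ∈ L → v ∈ x ∷ R → u ≢ v
    left-right = Unique-++⇒≢ L unique

    w-left : ∀ {v} → v ∈ L → w ≢ v
    w-left v∈L refl = Unique[x∷xs]⇒x∉xs fresh (∈-++⁺ˡ v∈L)

    w-right : ∀ {v} → v ∈ x ∷ R → w ≢ v
    w-right v∈R refl = Unique[x∷xs]⇒x∉xs fresh (∈-++⁺ʳ L v∈R)

  flip : ∀ {a L y x z R b w} → Attached a L y x z R b w → Attached b (reverse R) z x y (reverse L) a w
  flip {L = L} {x = x} {R = R} {w = w} A = record
    { left = rev ~-sym right ; y~x = ~-sym x~z ; x~z = ~-sym y~x ; right = rev ~-sym left ; x~w = x~w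
    ; fresh = Unique-resp-↭ (prep w flipped) fresh
    ; max = longest λ p u → no-longer max p u ∘ subst (_< _) (≡-sym (↭-length flipped)) }
    where
    open Attached A
    flipped : L ++ x ∷ R ↭ reverse R ++ x ∷ reverse L
    flipped = ↭-trans (↭-Solver.solve 3 (λ l v r → l ⊕ (v ⊕ r) ⊜ r ⊕ (v ⊕ l)) ↭-refl L (x ∷ []) R)
      (++⁺ (↭-sym (↭-reverse R)) (prep x (↭-sym (↭-reverse L))))

  -- Otherwise `w` fits between `y` and `x`.
  w≉y : ∀ {a L y x z R b w} → Attached a L y x z R b w → ¬ (w ≈ y)
  w≉y {L = L} {w = w} A w≈y = extension (left≈ ++⟨ ≈-sym w≈y ⟩ inj₁ (~-sym x~w) ∷ inj₁ x~z ∷ right≈) (shift w L _)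
    where open Attached A

  w≉z : ∀ {a L y x z R b w} → Attached a L y x z R b w → ¬ (w ≈ z)
  w≉z A = w≉y (flip A)

  -- Otherwise `w` can be put in front of `a`.
  w≉a : ∀ {a L y x z R b w} → Attached a L y x z R b w → ¬ (w ≈ a)
  w≉a A w≈a = extension (w≈a ∷ (left≈ ++⟨ inj₁ y~x ⟩ inj₁ x~z ∷ right≈)) ↭-refl
    where open Attached A

  w≉b : ∀ {a L y x z R b w} → Attached a L y x z R b w → ¬ (w ≈ b)
  w≉b A = w≉a (flip A)

  -- Otherwise w, x, then y back to a, then b back to z is a longer path.
  a≉b : ∀ {a L y x z R b w} → Attached a L y x z R b w → ¬ (a ≈ b)
  a≉b {L = L} {x = x} {R = R} {w = w} A a≈b = extension
    (inj₁ (~-sym x~w) ∷ inj₁ (~-sym y~x) ∷ (rev ≈-sym left≈ ++⟨ a≈b ⟩ rev ≈-sym right≈))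
    (prep w (↭-trans (prep x (++⁺ (↭-reverse L) (↭-reverse R))) (↭-sym (shift x L R))))
    where open Attached A

  -- Otherwise w, x, then y back to a, then z on to b is a longer path.
  a≉z : ∀ {a L y x z R b w} → Attached a L y x z R b w → ¬ (a ≈ z)
  a≉z {L = L} {x = x} {R = R} {w = w} A a≈z = extension
    (inj₁ (~-sym x~w) ∷ inj₁ (~-sym y~x) ∷ (rev ≈-sym left≈ ++⟨ a≈z ⟩ right≈))
    (prep w (↭-trans (prep x (++⁺ʳ R (↭-reverse L))) (↭-sym (shift x L R))))
    where open Attached A

  b≉y : ∀ {a L y x z R b w} → Attached a L y x z R b w → ¬ (b ≈ y)
  b≉y A = a≉z (flip A)

  y≢z : ∀ {a L y x z R b w} → Attached a L y x z R b w → y ≢ z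
  y≢z A = left-right (last∈ left) (there (first∈ right))
    where open Attached A

  a≢b : ∀ {a L y x z R b w} → Attached a L y x z R b w → a ≢ b
  a≢b A = left-right (first∈ left) (there (last∈ right))
    where open Attached A

  -- Otherwise `x` is the centre of a light claw with leaves w, y, z.
  y≈z : ∀ {a L y x z R b w} → Attached a L y x z R b w → y ≈ z
  y≈z A = decidable-stable (_ ≈? _) λ y≉z →
    no-light-claw x~w (~-sym y~x) x~z (w-left (last∈ left)) (w-right (there (first∈ right))) (y≢z A)
      (w≉y A) (w≉z A) y≉z
    where open Attached A

-- The case of `P4`

module P4Free {n : ℕ} (G : Graph n) (connected : Connected G) (free : Free P4 G) where

  open Adjacency G

  -- Induction along a walk: if it has been shortened to u, t, c, v and no further shortcut exists,
  -- these four vertices induce `P4`.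
  near : ∀ {u v} → Reach G u v → u ≡ v ⊎ u ~ v ⊎ (∃[ c ] u ~ c × c ~ v)
  near here = inj₁ refl
  near {u} {v} (step {v = t} u~t t⇝v) with near t⇝v
  ... | inj₁ refl = inj₂ (inj₁ u~t)
  ... | inj₂ (inj₁ t~v) = inj₂ (inj₂ (t , u~t , t~v))
  ... | inj₂ (inj₂ (c , t~c , c~v)) with u Fin.≟ v | u ~? v | u ~? c | t ~? v
  ...   | yes u≡v | _ | _ | _ = inj₁ u≡v
  ...   | _ | yes u~v | _ | _ = inj₂ (inj₁ u~v)
  ...   | _ | _ | yes u~c | _ = inj₂ (inj₂ (c , u~c , c~v))
  ...   | _ | _ | _ | yes t~v = inj₂ (inj₂ (t , u~t , t~v))
  ...   | no u≢v | no u≁v | no u≁c | no t≁v = contradiction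
    (quad u t c v , quad-embeds P4 G (~⇒≢ u~t) (λ { refl → u≁v c~v }) u≢v (~⇒≢ t~c) (λ { refl → u≁v u~t }) (~⇒≢ c~v)
      u~t (≁⇒≡false u≁c) (≁⇒≡false u≁v) t~c (≁⇒≡false t≁v) c~v) free

  -- Take `c` between p and q, and `d` between q and r. If neither is adjacent to all three, then p
  -- c d r or p c q d induces `P4`, according to whether c and d are adjacent.
  common-neighbour : ∀ {p q r} → p ≢ q → p ≢ r → q ≢ r → ¬ (p ~ q) → ¬ (p ~ r) → ¬ (q ~ r) →
    ∃[ c ] c ~ p × c ~ q × c ~ r
  common-neighbour {p} {q} {r} p≢q p≢r q≢r p≁q p≁r q≁r with near (connected p q) | near (connected q r)
  ... | inj₁ p≡q | _ = contradiction p≡q p≢q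
  ... | inj₂ (inj₁ p~q) | _ = contradiction p~q p≁q
  ... | _ | inj₁ q≡r = contradiction q≡r q≢r
  ... | _ | inj₂ (inj₁ q~r) = contradiction q~r q≁r
  ... | inj₂ (inj₂ (c , p~c , c~q)) | inj₂ (inj₂ (d , q~d , d~r)) with c ~? r | d ~? p | c ~? d
  ...   | yes c~r | _ | _ = c , ~-sym p~c , c~q , c~r
  ...   | _ | yes d~p | _ = d , d~p , ~-sym q~d , d~r
  ...   | no c≁r | no d≁p | yes c~d = contradiction
    (quad p c d r , quad-embeds P4 G (~⇒≢ p~c) (λ { refl → p≁r d~r }) p≢r (~⇒≢ c~d) (λ { refl → p≁r p~c }) (~⇒≢ d~r)
      p~c (≁⇒≡false (d≁p ∘ ~-sym)) (≁⇒≡false p≁r) c~d (≁⇒≡false c≁r) d~r) free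
  ...   | no c≁r | no d≁p | no c≁d = contradiction
    (quad p c q d , quad-embeds P4 G (~⇒≢ p~c) p≢q (λ { refl → p≁r d~r }) (~⇒≢ c~q) (λ { refl → c≁r d~r }) (~⇒≢ q~d)
      p~c (≁⇒≡false p≁q) (≁⇒≡false (d≁p ∘ ~-sym)) c~q (≁⇒≡false c≁d) q~d) free

  module _ (heavy : ClawO-1Heavy G) where

    open ClawHeavy G heavy

    P4-free-unattached : ∀ {a L y x z R b w} → ¬ Attached a L y x z R b w
    P4-free-unattached A with common-neighbour (w-left (first∈ left)) (w-right (there (last∈ right))) (a≢b A)
      (w≉a A ∘ inj₁) (w≉b A ∘ inj₁) (a≉b A ∘ inj₁)
      where open Attached A
    ... | c , c~w , c~a , c~b = no-light-claw c~w c~a c~b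
      (w-left (first∈ left)) (w-right (there (last∈ right))) (a≢b A) (w≉a A) (w≉b A) (a≉b A)
      where open Attached A

-- The case of `Z1`: triangles and common neighbours near the attachment

module Z1Free {n : ℕ} (G : Graph n) (free : Free Z1 G) (heavy : ClawO-1Heavy G) where

  open Adjacency G
  open ↭-Solver using (_⊕_; _⊜_)
  open ClawHeavy G heavy

  -- The graph to be avoided is the triangle v p q with `c` pendant at `v`.
  paw-free : ∀ {v p q c} → v ~ p → v ~ q → p ~ q → v ~ c → c ≢ p → c ≢ q → c ~ p ⊎ c ~ q
  paw-free {v} {p} {q} {c} v~p v~q p~q v~c c≢p c≢q with c ~? p | c ~? q
  ... | yes c~p | _ = inj₁ c~p
  ... | _ | yes c~q = inj₂ c~q
  ... | no c≁p | no c≁q = contradiction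
    (quad v p q c , quad-embeds Z1 G (~⇒≢ v~p) (~⇒≢ v~q) (~⇒≢ v~c) (~⇒≢ p~q) (≢-sym c≢p) (≢-sym c≢q)
      v~p v~q v~c p~q (≁⇒≡false (c≁p ∘ ~-sym)) (≁⇒≡false (c≁q ∘ ~-sym))) free

  module _ {a L y x z R b w} (A : Attached a L y x z R b w) where

    open Attached A

    -- In a triangle x y z, the vertex `w` would be pendant at `x`.
    y≁z : ¬ (y ~ z)
    y≁z y~z = [ w≉y A ∘ inj₁ , w≉z A ∘ inj₁ ]′
      (paw-free (~-sym y~x) x~z y~z x~w (w-left (last∈ left)) (w-right (there (first∈ right))))

    y-z-heavy : Heavy y z
    y-z-heavy = [ (λ y~z → contradiction y~z y≁z) , id ]′ (y≈z A)

    -- The pair y, z is heavy and the pair w, y is not; cancel d(y).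
    deg-w<deg-z : deg G w < deg G z
    deg-w<deg-z = ≤-cancel (deg G y + 1) (≤-trans (≰⇒> (w≉y A ∘ inj₂)) y-z-heavy)
      (eq₁ (deg G w) (deg G y)) (eq₂ (deg G y) (deg G z))
      where
      eq₁ : ∀ s t → suc (s + t + 1) ≡ suc s + (t + 1)
      eq₁ = solve-∀
      eq₂ : ∀ s t → s + t + 1 ≡ t + (s + 1)
      eq₂ = solve-∀

    triangle-xw⇒y~ : ∀ {u} → u ~ x → u ~ w → y ~ u
    triangle-xw⇒y~ u~x u~w = [ id , (λ y~w → contradiction (inj₁ (~-sym y~w)) (w≉y A)) ]′
      (paw-free (~-sym u~x) x~w u~w (~-sym y~x) (λ { refl → w≉y A (inj₁ (~-sym u~w)) }) (≢-sym (w-left (last∈ left))))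

  -- The neighbours of u along the path may be joined directly, which frees u for the detour y u w x.
  no-detour : ∀ {a L y x z R b w u} → Attached a L y x z R b w → u ∈ L → u ~ w → y ~ u → ⊥
  no-detour {x = x} {R = R} {w = w} {u} A u∈L u~w y~u with locate (Attached.left A) u∈L
  ... | inj₁ refl = w≉a A (inj₁ (~-sym u~w))
  ... | inj₂ (inj₁ refl) = ~⇒≢ y~u refl
  ... | inj₂ (inj₂ (interior {pre} {post} refl p i o q)) = extension
    (path-≈ p ++⟨ y≈z at-u ⟩ path-≈ q ++⟨ inj₁ y~u ⟩ inj₁ u~w ∷ inj₁ (~-sym x~w) ∷ inj₁ x~z ∷ right≈)
    (↭-Solver.solve 6
      (λ l l′ s t v r → l ⊕ (l′ ⊕ (s ⊕ (t ⊕ (v ⊕ r)))) ⊜ t ⊕ ((l ⊕ (s ⊕ l′)) ⊕ (v ⊕ r)))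
      ↭-refl pre post (u ∷ []) (w ∷ []) (x ∷ []) R)
    where
    open Attached A
    regroup : (pre ++ u ∷ post) ++ x ∷ R ≡ pre ++ u ∷ (post ++ x ∷ R)
    regroup = ++-assoc pre (u ∷ post) (x ∷ R)
    at-u : Attached _ pre _ u _ (post ++ x ∷ R) _ w
    at-u = record
      { left = p ; y~x = i ; x~z = o ; right = q ++⟨ y~x ⟩ x~z ∷ right ; x~w = u~w
      ; fresh = subst (λ l → Unique (w ∷ l)) regroup fresh
      ; max = subst Longest regroup max }

  -- Here `u` would be adjacent to both `y` and `z`. Outside the path it could be inserted before
  -- `x`; on the path it allows a detour through `w`, on one side or, by symmetry, on the other.
  no-triangle-xw : ∀ {a L y x z R b w u} → Attached a L y x z R b w → u ~ x → ¬ (u ~ w)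
  no-triangle-xw {L = L} {x = x} {R = R} {w = w} {u} A u~x u~w with u ∈? w ∷ L ++ x ∷ R
  ... | yes (here u≡w) = ~⇒≢ u~w u≡w
  ... | no u∉ = no-extension max (Unique-∷ (u∉ ∘ there) unique)
    (left≈ ++⟨ inj₁ (triangle-xw⇒y~ A u~x u~w) ⟩ inj₁ u~x ∷ inj₁ x~z ∷ right≈) (shift u L _)
    where open Attached A
  ... | yes (there u∈) with ∈-++⁻ L u∈
  ...   | inj₁ u∈L = no-detour A u∈L u~w (triangle-xw⇒y~ A u~x u~w)
  ...   | inj₂ (here u≡x) = ~⇒≢ u~x u≡x
  ...   | inj₂ (there u∈R) = no-detour (flip A) (∈-resp-↭ (↭-sym (↭-reverse R)) u∈R) u~w (triangle-xw⇒y~ (flip A) u~x u~w)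

  -- Since `w` is a further neighbour of `x`, it would be adjacent to `y` or would form a triangle x
  -- u w.
  no-triangle-xy : ∀ {a L y x z R b w u} → Attached a L y x z R b w → u ~ x → ¬ (u ~ y)
  no-triangle-xy A u~x u~y = [ w≉y A ∘ inj₁ , no-triangle-xw A u~x ∘ ~-sym ]′
    (paw-free (~-sym y~x) (~-sym u~x) (~-sym u~y) x~w (w-left (last∈ left)) (λ { refl → w≉y A (inj₁ u~y) }))
    where open Attached A

  -- In a triangle y u v without `x`, the further neighbour `x` of `y` is adjacent to u or v, which
  -- gives a triangle on the edge x y.
  N[y]-independent : ∀ {a L y x z R b w u v} → Attached a L y x z R b w → y ~ u → y ~ v → ¬ (u ~ v)
  N[y]-independent {x = x} {u = u} {v} A y~u y~v u~v with x Fin.≟ u | x Fin.≟ v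
  ... | yes refl | _ = no-triangle-xy A (~-sym u~v) (~-sym y~v)
  ... | _ | yes refl = no-triangle-xy A u~v (~-sym y~u)
  ... | no x≢u | no x≢v = [ (λ x~u → no-triangle-xy A (~-sym x~u) (~-sym y~u)) , (λ x~v → no-triangle-xy A (~-sym x~v) (~-sym y~v)) ]′
    (paw-free y~u y~v u~v (Attached.y~x A) x≢u x≢v)

  -- Exchanging x and u gives another longest path, and deg-w<deg-z applies to both, at y.
  no-common-outside : ∀ {a L y x z R b w u} → Attached a L y x z R b w → y ~ u → z ~ u → ¬ (u ∉ L ++ x ∷ R)
  no-common-outside {L = L} {x = x} {R = R} {u = u} A y~u z~u u∉ with unsnoc (Attached.left A)
  ... | inj₁ (refl , refl) = no-extension max (Unique-∷ u∉ unique)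
    (inj₁ (~-sym y~u) ∷ (left≈ ++⟨ inj₁ y~x ⟩ inj₁ x~z ∷ right≈)) ↭-refl
    where open Attached A
  no-common-outside {y = y} {x} {z} {R} {b} {u = u} A y~u z~u u∉ | inj₂ (L₀ , y₀ , refl , p , y₀~y) =
    <-asym (deg-w<deg-z at-y) (deg-w<deg-z at-y′)
    where
    open Attached A
    regroup : (L₀ ++ y ∷ []) ++ x ∷ R ≡ L₀ ++ y ∷ x ∷ R
    regroup = ++-assoc L₀ (y ∷ []) (x ∷ R)
    exchange : u ∷ (L₀ ++ y ∷ []) ++ x ∷ R ↭ x ∷ L₀ ++ y ∷ u ∷ R
    exchange = ↭-Solver.solve 5 (λ l s t v r → t ⊕ ((l ⊕ s) ⊕ (v ⊕ r)) ⊜ v ⊕ (l ⊕ (s ⊕ (t ⊕ r))))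
      ↭-refl L₀ (y ∷ []) (u ∷ []) (x ∷ []) R
    at-y : Attached _ L₀ y₀ y x (x ∷ R) b u
    at-y = record
      { left = p ; y~x = y₀~y ; x~z = y~x ; right = x~z ∷ right ; x~w = y~u
      ; fresh = subst (λ l → Unique (u ∷ l)) regroup (Unique-∷ u∉ unique)
      ; max = subst Longest regroup max }
    at-y′ : Attached _ L₀ y₀ y u (u ∷ R) b x
    at-y′ = record
      { left = p ; y~x = y₀~y ; x~z = y~u ; right = ~-sym z~u ∷ right ; x~w = y~x
      ; fresh = Unique-resp-↭ exchange (Unique-∷ u∉ unique)
      ; max = longest λ q v → Longest.no-longer max q v ∘ subst (_< _) (≡-sym (suc-injective (↭-length exchange))) }

  -- The predecessor of `s` on the path will do. It exists because `a`, unlike `s`, is not adjacent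
  -- to `z`.
  neighbour-off-yz : ∀ {a L y x z R b w s} → Attached a L y x z R b w → s ∈ L → y ~ s → z ~ s →
    ∃[ v ] s ~ v × v ≢ y × v ≢ z × v ≢ w
  neighbour-off-yz A s∈L y~s z~s with locate (Attached.left A) s∈L
  ... | inj₁ refl = contradiction (inj₁ (~-sym z~s)) (a≉z A)
  ... | inj₂ (inj₁ refl) = contradiction refl (~⇒≢ y~s)
  ... | inj₂ (inj₂ (interior {pre} refl p i o q)) = _ , ~-sym i ,
    Unique-++⇒≢ pre (Unique-++⇒ˡ _ unique) (last∈ p) (there (last∈ q)) ,
    left-right (∈-++⁺ˡ (last∈ p)) (there (first∈ right)) ,
    ≢-sym (w-left (∈-++⁺ˡ (last∈ p)))
    where open Attached A

  joint≤2 : ∀ y z v → joint y z v ≤ 2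
  joint≤2 y z v = +-mono-≤ (⟦⟧≤1 (adj G y v)) (⟦⟧≤1 (adj G z v))

  joint≡0 : ∀ {y z v} → ¬ (y ~ v) → ¬ (z ~ v) → joint y z v ≡ 0
  joint≡0 y≁v z≁v = cong₂ _+_ (≁⇒⟦⟧≡0 y≁v) (≁⇒⟦⟧≡0 z≁v)

  ≁-refl : ∀ {v} → ¬ (v ~ v)
  ≁-refl v~v = ~⇒≢ v~v refl

  -- `Heavy p p` says that d(p) is at least (n - 1)/2, which holds for the vertex of larger degree
  -- in a heavy pair.
  heavy-half : ∀ {p q} → Heavy p q → Heavy p p ⊎ Heavy q q
  heavy-half {p} {q} h with ≤-total (deg G p) (deg G q)
  ... | inj₁ p≤q = inj₂ (≤-trans h (+-monoˡ-≤ 1 (+-monoˡ-≤ (deg G q) p≤q)))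
  ... | inj₂ q≤p = inj₁ (≤-trans h (+-monoˡ-≤ 1 (+-monoʳ-≤ (deg G p) q≤p)))

  -- The case of `Z1`: counting the neighbours of `y` and `z`

  module Counting {a L y x z R b w} (A : Attached a L y x z R b w) where

    open Attached A

    y≢w : y ≢ w
    y≢w = ≢-sym (w-left (last∈ left))

    z≢w : z ≢ w
    z≢w = ≢-sym (w-right (there (first∈ right)))

    N[z]-independent : ∀ {u v} → z ~ u → z ~ v → ¬ (u ~ v)
    N[z]-independent = N[y]-independent (flip A)

    joint-y : joint y z y ≡ 0
    joint-y = joint≡0 ≁-refl (y≁z A ∘ ~-sym)

    joint-z : joint y z z ≡ 0
    joint-z = joint≡0 (y≁z A) ≁-refl

    joint-w : joint y z w ≡ 0
    joint-w = joint≡0 (w≉y A ∘ inj₁ ∘ ~-sym) (w≉z A ∘ inj₁ ∘ ~-sym)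

    yzw-unique : Unique (y ∷ z ∷ w ∷ [])
    yzw-unique = (y≢z A ∷ y≢w ∷ []) ∷ (z≢w ∷ []) ∷ [] ∷ []

    -- Neither `y`, `z` nor `w` is adjacent to y or z. If only `x` were a common neighbour, then
    -- d(y) + d(z) would be at most 2 + (n - 4) = n - 2.
    second-common : ∃[ s ] y ~ s × z ~ s × s ≢ x
    second-common with excess (joint y z) 1 {x ∷ y ∷ z ∷ w ∷ []}
      ((≢-sym (~⇒≢ y~x) ∷ ~⇒≢ x~z ∷ ~⇒≢ x~w ∷ []) ∷ yzw-unique)
    ... | inj₁ (s , s∉ , s>1) = s , proj₁ (joint>1 s>1) , proj₂ (joint>1 {y} {z} s>1) , s∉ ∘ here
    ... | inj₂ h rewrite joint-y | joint-z | joint-w | ∑-joint y z =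
      ⊥-elim (≤-absurd 0 (+-mono-≤ (+-mono-≤ h (joint≤2 y z x)) (y-z-heavy A)) (eq (deg G y) (deg G z) (joint y z x) n))
      where
      eq : ∀ d e s n → d + e + 4 + s + n ≡ s + 0 + n * 1 + 2 + (d + e + 1) + 1
      eq = solve-∀

    -- By `no-common-outside`, `s` lies on the path and has a neighbour `v` there other than y and
    -- z, which by independence is adjacent to neither. With x and s as the only common neighbours,
    -- d(y) + d(z) would be at most 4 + (n - 6) = n - 2.
    third-common : ∀ {s} → y ~ s → z ~ s → s ≢ x → ∃[ t ] y ~ t × z ~ t × t ≢ x × t ≢ s
    third-common {s} y~s z~s s≢x = count off
      where
      off : ∃[ v ] s ~ v × v ≢ y × v ≢ z × v ≢ w
      off with s ∈? L ++ x ∷ R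
      ... | no s∉ = contradiction s∉ (no-common-outside A y~s z~s)
      ... | yes s∈ with ∈-++⁻ L s∈
      ...   | inj₁ s∈L = neighbour-off-yz A s∈L y~s z~s
      ...   | inj₂ (here s≡x) = contradiction s≡x s≢x
      ...   | inj₂ (there s∈R) with neighbour-off-yz (flip A) (∈-resp-↭ (↭-sym (↭-reverse R)) s∈R) z~s y~s
      ...     | v , s~v , v≢z , v≢y , v≢w = v , s~v , v≢y , v≢z , v≢w
      count : ∃[ v ] s ~ v × v ≢ y × v ≢ z × v ≢ w → ∃[ t ] y ~ t × z ~ t × t ≢ x × t ≢ s
      count (v , s~v , v≢y , v≢z , v≢w) with excess (joint y z) 1 {x ∷ s ∷ v ∷ y ∷ z ∷ w ∷ []}
        ((≢-sym s≢x ∷ (λ { refl → N[y]-independent A y~s y~x s~v }) ∷ ≢-sym (~⇒≢ y~x) ∷ ~⇒≢ x~z ∷ ~⇒≢ x~w ∷ [])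
        ∷ (~⇒≢ s~v ∷ ≢-sym (~⇒≢ y~s) ∷ ≢-sym (~⇒≢ z~s) ∷ (λ { refl → w≉y A (inj₁ (~-sym y~s)) }) ∷ [])
        ∷ (v≢y ∷ v≢z ∷ v≢w ∷ []) ∷ yzw-unique)
      ... | inj₁ (t , t∉ , t>1) = t , proj₁ (joint>1 t>1) , proj₂ (joint>1 {y} {z} t>1) , t∉ ∘ here , t∉ ∘ there ∘ here
      ... | inj₂ h
        rewrite joint-y | joint-z | joint-w | ∑-joint y z
          | joint≡0 {y} {z} {v} (λ y~v → N[y]-independent A y~s y~v s~v) (λ z~v → N[z]-independent z~s z~v s~v) =
        ⊥-elim (≤-absurd 0 (+-mono-≤ (+-mono-≤ h (joint≤2 y z x)) (+-mono-≤ (joint≤2 y z s) (y-z-heavy A)))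
          (eq (deg G y) (deg G z) (joint y z x) (joint y z s) n))
        where
        eq : ∀ d e s t n → d + e + 6 + s + (t + n) ≡ s + (t + 0) + n * 1 + 2 + (2 + (d + e + 1)) + 1
        eq = solve-∀

    -- Three common neighbours are independent, so they are the leaves of a claw centred at `y`, and
    -- two of them form a heavy pair.
    large-common : ∃[ s ] y ~ s × z ~ s × Heavy s s
    large-common with second-common
    ... | s , y~s , z~s , s≢x with third-common y~s z~s s≢x
    ...   | t , y~t , z~t , t≢x , t≢s = case claw⇒heavy y~x y~s y~t (≢-sym s≢x) (≢-sym t≢x) (≢-sym t≢s)
        (N[y]-independent A y~x y~s) (N[y]-independent A y~x y~t) (N[y]-independent A y~s y~t) of λ where
      (inj₁ h) → [ (λ h → x , y~x , ~-sym x~z , h) , (λ h → s , y~s , z~s , h) ]′ (heavy-half {x} {s} h)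
      (inj₂ (inj₁ h)) → [ (λ h → x , y~x , ~-sym x~z , h) , (λ h → t , y~t , z~t , h) ]′ (heavy-half {x} {t} h)
      (inj₂ (inj₂ h)) → [ (λ h → s , y~s , z~s , h) , (λ h → t , y~t , z~t , h) ]′ (heavy-half {s} {t} h)

    module _ {s} (y~s : y ~ s) (z~s : z ~ s) (large : Heavy s s) where

      -- Neighbours of `s` are adjacent to neither y nor z, so every value is at most 2, while the
      -- sum is at least 2(n - 1). The values thus fall short of 2 by at most 2 in total.
      g : Fin n → ℕ
      g v = joint y z v + joint s s v

      ∑g : ∑ g ≡ deg G y + deg G z + (deg G s + deg G s)
      ∑g = trans (sum-map-+ (joint y z) (joint s s) (allFin n)) (cong₂ _+_ (∑-joint y z) (∑-joint s s))

      s~⇒joint≡0 : ∀ {v} → s ~ v → joint y z v ≡ 0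
      s~⇒joint≡0 s~v = joint≡0 (λ y~v → N[y]-independent A y~s y~v s~v) (λ z~v → N[z]-independent z~s z~v s~v)

      g≤2 : ∀ v → g v ≤ 2
      g≤2 v with s ~? v
      ... | yes s~v rewrite s~⇒joint≡0 s~v = joint≤2 s s v
      ... | no s≁v rewrite joint≡0 s≁v s≁v = ≤-trans (≤-reflexive (+-identityʳ _)) (joint≤2 y z v)

      g-excess : ∀ {l} → Unique l → ∑ g + length l * 2 ≤ sum (map g l) + n * 2
      g-excess u with excess g 2 u
      ... | inj₁ (v , _ , v>2) = contradiction v>2 (≤⇒≯ (g≤2 v))
      ... | inj₂ h = h

      -- Otherwise g, whose sum is at least 2n - 2, falls short of 2 by 3 in total: by 1 at v,
      -- and either by 2 at w, or, if s ~ w, by 1 at each of a and b.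
      joint≡1⇒end : ∀ {v} → joint y z v ≡ 1 → v ≡ a ⊎ v ≡ b
      joint≡1⇒end {v} f≡1 with v Fin.≟ a | v Fin.≟ b
      ... | yes v≡a | _ = inj₁ v≡a
      ... | _ | yes v≡b = inj₂ v≡b
      ... | no v≢a | no v≢b = ⊥-elim (case s ~? w of λ where
          (no s≁w) → light s≁w
          (yes s~w) → heavy-w s~w)
        where
        s≁v : ¬ (s ~ v)
        s≁v s~v = contradiction (trans (≡-sym (s~⇒joint≡0 s~v)) f≡1) (λ ())
        light : ¬ (s ~ w) → ⊥
        light s≁w with g-excess {v ∷ w ∷ []} (((λ { refl → contradiction (trans (≡-sym joint-w) f≡1) (λ ()) }) ∷ []) ∷ [] ∷ [])
        ... | h rewrite ∑g | f≡1 | joint-w | joint≡0 s≁v s≁v | joint≡0 s≁w s≁w =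
          ≤-absurd 0 (+-mono-≤ h (+-mono-≤ (y-z-heavy A) large)) (eq (deg G y) (deg G z) (deg G s) n)
          where
          eq : ∀ d e s n → d + e + (s + s) + 4 + (n + n) ≡ 1 + n * 2 + (d + e + 1 + (s + s + 1)) + 1
          eq = solve-∀
        -- Otherwise `s` is the centre of a light claw with leaves w, z, a. For `b` the leaves are
        -- w, y, b.
        s≁a : s ~ w → ¬ (s ~ a)
        s≁a s~w s~a = no-light-claw s~w (~-sym z~s) s~a (≢-sym z≢w) (w-left (first∈ left))
            (λ { refl → left-right (first∈ left) (there (first∈ right)) refl }) (w≉z A) (w≉a A) (a≉z A ∘ ≈-sym)
        s≁b : s ~ w → ¬ (s ~ b)
        s≁b s~w s~b = no-light-claw s~w (~-sym y~s) s~b (≢-sym y≢w) (w-right (there (last∈ right)))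
            (λ { refl → left-right (last∈ left) (there (last∈ right)) refl }) (w≉y A) (w≉b A) (b≉y A ∘ ≈-sym)
        heavy-w : s ~ w → ⊥
        heavy-w s~w with g-excess {v ∷ a ∷ b ∷ []} ((v≢a ∷ v≢b ∷ []) ∷ (a≢b A ∷ []) ∷ [] ∷ [])
        ... | h rewrite ∑g | f≡1 | joint≡0 s≁v s≁v | joint≡0 (s≁a s~w) (s≁a s~w) | joint≡0 (s≁b s~w) (s≁b s~w)
            | ≁⇒⟦⟧≡0 (a≉z A ∘ inj₁ ∘ ~-sym) | ≁⇒⟦⟧≡0 (b≉y A ∘ inj₁ ∘ ~-sym) =
          ≤-absurd 0 (+-mono-≤ (+-mono-≤ h (+-mono-≤ (⟦⟧≤1 (adj G y a)) (⟦⟧≤1 (adj G z b)))) (+-mono-≤ (y-z-heavy A) large))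
            (eq (deg G y) (deg G z) (deg G s) n ⟦ adj G y a ⟧ ⟦ adj G z b ⟧)
          where
          eq : ∀ d e s n i j → d + e + (s + s) + 6 + (i + j) + (n + n) ≡
            1 + (i + 0 + 0 + (0 + j + 0 + 0)) + n * 2 + 2 + (d + e + 1 + (s + s + 1)) + 1
          eq = solve-∀

      y-only⇒end : ∀ {v} → y ~ v → ¬ (z ~ v) → v ≡ a ⊎ v ≡ b
      y-only⇒end y~v z≁v = joint≡1⇒end (cong₂ _+_ (~⇒⟦⟧≡1 y~v) (≁⇒⟦⟧≡0 z≁v))

      z-only⇒end : ∀ {v} → ¬ (y ~ v) → z ~ v → v ≡ a ⊎ v ≡ b
      z-only⇒end y≁v z~v = joint≡1⇒end (cong₂ _+_ (≁⇒⟦⟧≡0 y≁v) (~⇒⟦⟧≡1 z~v))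

      outside-end : ∀ {v} → v ∉ L ++ x ∷ R → ¬ (v ≡ a ⊎ v ≡ b)
      outside-end v∉ (inj₁ refl) = v∉ (∈-++⁺ˡ (first∈ left))
      outside-end v∉ (inj₂ refl) = v∉ (∈-++⁺ʳ L (there (last∈ right)))

      P : List (Fin n)
      P = L ++ x ∷ R

      -- By independence, c is adjacent to y but not z, and d to z but not y. Both are therefore
      -- ends of the path, and the ends are not adjacent.
      no-crossing : ¬ Crossing {R = _~_} (adj G y) (adj G z) a P b
      no-crossing (crossing _ _ c~d _ y~c z~d) =
        ends (y-only⇒end y~c (λ z~c → N[z]-independent z~c z~d c~d))
          (z-only⇒end (λ y~d → N[y]-independent A y~c y~d c~d) z~d) c~d
        where
        ends : ∀ {c d} → c ≡ a ⊎ c ≡ b → d ≡ a ⊎ d ≡ b → ¬ (c ~ d)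
        ends (inj₁ refl) (inj₁ refl) = ≁-refl
        ends (inj₁ refl) (inj₂ refl) = a≉b A ∘ inj₁
        ends (inj₂ refl) (inj₁ refl) = a≉b A ∘ inj₁ ∘ ~-sym
        ends (inj₂ refl) (inj₂ refl) = ≁-refl

      -- A neighbour of both is excluded by `no-common-outside`; a neighbour of exactly one is an
      -- end and so lies on `P`.
      joint-outside : ∀ {v} → v ∉ P → ¬ (0 < joint y z v)
      joint-outside {v} v∉ v>0 with y ~? v | z ~? v
      ... | yes y~v | yes z~v = no-common-outside A y~v z~v v∉
      ... | no y≁v | no z≁v = <-irrefl (≡-sym (joint≡0 y≁v z≁v)) v>0
      ... | yes y~v | no z≁v = outside-end v∉ (y-only⇒end y~v z≁v)
      ... | no y≁v | yes z~v = outside-end v∉ (z-only⇒end y≁v z~v)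

      joint-on-P≥ : deg G y + deg G z ≤ sum (map (joint y z) P)
      joint-on-P≥ = subst (_≤ sum (map (joint y z) P)) (∑-joint y z) (∑-supported (joint y z) unique joint-outside)

      -- There is no crossing, and the end terms vanish because `z` is not adjacent to `a`, nor `y`
      -- to `b`.
      joint-on-P< : sum (map (joint y z) P) < length P
      joint-on-P< = [ (λ c → contradiction c no-crossing) , (λ h → ≤-trans (≤-reflexive (+-comm 1 _)) (≤-trans h
        (≤-reflexive (trans (cong₂ (λ i j → i + length P + j) (≁⇒⟦⟧≡0 (a≉z A ∘ inj₁ ∘ ~-sym)) (≁⇒⟦⟧≡0 (b≉y A ∘ inj₁ ∘ ~-sym)))
          (+-identityʳ (length P)))))) ]′
        (cross (adj G y) (adj G z) (left ++⟨ y~x ⟩ x~z ∷ right))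

      unattached : ⊥
      unattached = <-irrefl refl (begin-strict
        n                             ≤⟨ y-z-heavy A ⟩
        deg G y + deg G z + 1         ≡⟨ +-comm (deg G y + deg G z) 1 ⟩
        suc (deg G y + deg G z)       ≤⟨ s≤s joint-on-P≥ ⟩
        suc (sum (map (joint y z) P)) ≤⟨ joint-on-P< ⟩
        length P                      <⟨ Unique-length fresh ⟩
        n                             ∎)
        where open ≤-Reasoning

  Z1-free-unattached : ∀ {a L y x z R b w} → ¬ Attached a L y x z R b w
  Z1-free-unattached A =
    let s , y~s , z~s , large = Counting.large-common A in Counting.unattached A {s} y~s z~s large

-- From longest paths to traceability

any-vec? : ∀ {k n} {P : Vec (Fin n) k → Set} → (∀ v → Dec (P v)) → Dec (∃ P)
any-vec? {zero} P? = map′ (λ p → [] , p) (λ { ([] , p) → p }) (P? [])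
any-vec? {suc k} P? = map′ (λ { (i , v , p) → i ∷ v , p }) (λ { (i ∷ v , p) → i , v , p })
  (Fin.any? λ i → any-vec? λ v → P? (i ∷ v))

path⇒linked : ∀ {A : Set} {R : A → A → Set} {a l b} → Path R a l b → Linked R l
path⇒linked [ a ] = [-]
path⇒linked (r ∷ [ b ]) = r ∷ [-]
path⇒linked (r ∷ s ∷ p) = r ∷ path⇒linked (s ∷ p)

module Tracing {n : ℕ} (G : Graph n) (connected : Connected G) (heavy : ClawO-1Heavy G) where

  open Adjacency G
  open ClawHeavy G heavy

  Hamiltonian : List (Fin n) → Set
  Hamiltonian l = Linked _~_ l × Unique l

  hamiltonian⇒traceable : ∀ {l} → length l ≡ n → Hamiltonian l → Traceable G
  hamiltonian⇒traceable {l} |l|≡n (linked , u) = l , linked , u , covers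
    where
    covers : ∀ v → v ∈ l
    covers v = decidable-stable (v ∈? l) λ v∉l →
      <-irrefl |l|≡n (Unique-length (Unique-∷ v∉l u))

  exit : ∀ {l u v} → Reach G u v → u ∈ l → v ∉ l → ∃[ x ] ∃[ w ] x ∈ l × w ∉ l × x ~ w
  exit here u∈ u∉ = contradiction u∈ u∉
  exit {l} {u} (step {v = t} u~t t⇝v) u∈ v∉ with t ∈? l
  ... | yes t∈ = exit t⇝v t∈ v∉
  ... | no t∉ = u , t , u∈ , t∉ , u~t

  -- By connectedness some edge leaves a path that misses a vertex. At an end it lengthens the path;
  -- at an inner vertex it gives an `Attached` configuration.
  Longest⇒covers : (∀ {a L y x z R b w} → ¬ Attached a L y x z R b w) →
    ∀ {a l b} → Path _~_ a l b → Unique l → Longest l → ∀ v → v ∈ l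
  Longest⇒covers unattached {a} {l} p u m v = decidable-stable (v ∈? l) λ v∉ →
    case exit (connected a v) (first∈ p) v∉ of λ where
      (x , w , x∈ , w∉ , x~w) → case locate p x∈ of λ where
        (inj₁ refl) → no-extension m (Unique-∷ w∉ u) (inj₁ (~-sym x~w) ∷ path-≈ p) ↭-refl
        (inj₂ (inj₁ refl)) → no-extension m (Unique-∷ w∉ u) (path-≈ p ++⟨ inj₁ x~w ⟩ [ w ]) (++-comm l (w ∷ []))
        (inj₂ (inj₂ (interior refl p₁ i o p₂))) → unattached (record
          { left = p₁ ; y~x = i ; x~z = o ; right = p₂ ; x~w = x~w ; fresh = Unique-∷ w∉ u ; max = m })

  module _ (unattached : ∀ {a L y x z R b w} → ¬ Attached a L y x z R b w) where

    -- Under the assumption that `G` is not traceable, any longer path in `≈` is straightened and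
    -- grown again, with `k` bounding the number of missing vertices. Hence the path is longest. The
    -- double negation avoids deciding whether a longer path exists.
    grow : ∀ k {a l b} → n ≤ length l + k → Path _~_ a l b → Unique l → ¬ ¬ Traceable G
    grow k {l = l} n≤ p u untraceable =
      untraceable (l , path⇒linked p , u , Longest⇒covers unattached p u (longest (longer k n≤)))
      where
      longer : ∀ k → n ≤ length l + k → ∀ {c q d} → Path _≈_ c q d → Unique q → ¬ (length l < length q)
      longer zero n≤ q v l<q = <-irrefl refl (≤-trans l<q (≤-trans (Unique-length v) (subst (n ≤_) (+-identityʳ _) n≤)))
      longer (suc k) n≤ q v l<q with straighten q v
      ... | _ , l′ , _ , p′ , u′ , q≤l′ = grow k
        (≤-trans (subst (n ≤_) (+-suc (length l) k) n≤) (+-monoˡ-≤ k (≤-trans l<q q≤l′))) p′ u′ untraceable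

  -- A list that covers the vertices without repetition has exactly `n` entries, so a search through
  -- vectors of length `n` suffices.
  traceable? : Dec (Traceable G)
  traceable? = map′
    (λ (v , h) → hamiltonian⇒traceable (length-toList v) h)
    (λ (l , linked , u , covers) → let |l|≡n = ≤-antisym (Unique-length u) (covering-length covers)
      in subst (λ k → ∃[ v ] Hamiltonian (toList {n = k} v)) |l|≡n
        (fromList l , subst Hamiltonian (≡-sym (toList∘fromList l)) (linked , u)))
    (any-vec? λ v → linked? _~?_ (toList v) ×-dec unique? Fin._≟_ (toList v))
    where
    covering-length : ∀ {l} → (∀ v → v ∈ l) → n ≤ length l
    covering-length {l} covers with complement Unique-allFin (λ {v} _ → covers v)
    ... | r , q = ≤-trans (m≤m+n n (length r)) (≤-reflexive (≡-sym
      (trans (↭-length q) (trans (length-++ (allFin n)) (cong (_+ length r) length-allFin)))))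

unattached⇒traceable : ∀ {n} (G : Graph n) (connected : Connected G) (heavy : ClawO-1Heavy G) →
  (∀ {a L y x z R b w} → ¬ ClawHeavy.Attached G heavy a L y x z R b w) → Traceable G
-- A `Path` has at least one vertex, so the graph without vertices is treated separately.
unattached⇒traceable {zero} G _ _ _ = [] , [] , [] , λ ()
unattached⇒traceable {suc n} G connected heavy unattached =
  decidable-stable traceable? (grow unattached n ≤-refl [ zero ] ([] ∷ []))
  where open Tracing G connected heavy

Free-iso : ∀ {k m n} {S : Graph k} {T : Graph m} {G : Graph n} → Iso S T → Free S G → Free T G
Free-iso (f , g , gf , _ , adj-f) free (h , h-inj , adj-h) = free
  ((λ i → h (f i)) , (λ e → trans (≡-sym (gf _)) (trans (cong g (h-inj e)) (gf _))) ,
   (λ i j → trans (adj-h (f i) (f j)) (adj-f i j)))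

-- The first three vertices of `Z1` form its triangle.
C3-free⇒Z1-free : ∀ {n} {G : Graph n} → Free C3 G → Free Z1 G
C3-free⇒Z1-free {G = G} free (h , h-inj , adj-h) = free
  ((λ i → h (inject₁ i)) , (λ e → Fin.inject₁-injective (h-inj e)) ,
   (λ i j → trans (adj-h (inject₁ i) (inject₁ j)) (c3⊆z1 i j)))
  where
  c3⊆z1 : ∀ i j → adj Z1 (inject₁ i) (inject₁ j) ≡ adj C3 i j
  c3⊆z1 0F 0F = refl
  c3⊆z1 0F 1F = refl
  c3⊆z1 0F 2F = refl
  c3⊆z1 1F 0F = refl
  c3⊆z1 1F 1F = refl
  c3⊆z1 1F 2F = refl
  c3⊆z1 2F 0F = refl
  c3⊆z1 2F 1F = refl
  c3⊆z1 2F 2F = refl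

Z1-free⇒traceable : ∀ {n} (G : Graph n) → Connected G → ClawO-1Heavy G → Free Z1 G → Traceable G
Z1-free⇒traceable G connected heavy free =
  unattached⇒traceable G connected heavy (Z1Free.Z1-free-unattached G free heavy)

P4-free⇒traceable : ∀ {n} (G : Graph n) → Connected G → ClawO-1Heavy G → Free P4 G → Traceable G
P4-free⇒traceable G connected heavy free =
  unattached⇒traceable G connected heavy (P4Free.P4-free-unattached G connected free heavy)

-- Nontraceable examples

edges : List (ℕ × ℕ) → ∀ {n} → Fin n → Fin n → Bool
edges es u v = any (λ (i , j) → (i ≡ᵇ toℕ u) ∧ (j ≡ᵇ toℕ v) ∨ (i ≡ᵇ toℕ v) ∧ (j ≡ᵇ toℕ u)) es

Bull : Graph 5
Bull = mkGraph (edges ((0 , 1) ∷ (0 , 2) ∷ (1 , 2) ∷ (0 , 3) ∷ (1 , 4) ∷ []))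

Net : Graph 6
Net = mkGraph (edges ((0 , 1) ∷ (0 , 2) ∷ (1 , 2) ∷ (0 , 3) ∷ (1 , 4) ∷ (2 , 5) ∷ []))

-- The triangle 0 1 2 joined to the independent set 3 4 5, with one pendant vertex at each of 3, 4, 5.
-- The only claws have leaves 3, 4, 5, of degree 4 = (9 - 1) / 2, and 0, 1, 2 are twins,
-- whereas no two vertices of the triangle of a bull are twins.
Trident : Graph 9
Trident = mkGraph (edges
  ((0 , 1) ∷ (0 , 2) ∷ (1 , 2) ∷
   (0 , 3) ∷ (0 , 4) ∷ (0 , 5) ∷ (1 , 3) ∷ (1 , 4) ∷ (1 , 5) ∷ (2 , 3) ∷ (2 , 4) ∷ (2 , 5) ∷
   (3 , 6) ∷ (4 , 7) ∷ (5 , 8) ∷ []))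

linked⇒path : ∀ {A : Set} {R : A → A → Set} {a l} → Linked R (a ∷ l) → ∃[ b ] Path R a (a ∷ l) b
linked⇒path [-] = _ , [ _ ]
linked⇒path (r ∷ rs) with linked⇒path rs
... | b , p = b , r ∷ p

module Examples {n : ℕ} (G : Graph n) where

  open Adjacency G

  Leaf : Fin n → Set
  Leaf v = ∀ c d → v ~ c → v ~ d → c ≡ d

  leaf? : ∀ v → Dec (Leaf v)
  leaf? v = Fin.all? λ c → Fin.all? λ d → (v ~? c) →-dec (v ~? d) →-dec (c Fin.≟ d)

  -- An inner vertex has two different neighbours on the path.
  leaf-at-end : ∀ {a l b v} → Path _~_ a l b → Unique l → v ∈ l → Leaf v → v ≡ a ⊎ v ≡ b
  leaf-at-end p u v∈ leaf with locate p v∈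
  ... | inj₁ v≡a = inj₁ v≡a
  ... | inj₂ (inj₁ v≡b) = inj₂ v≡b
  ... | inj₂ (inj₂ (interior {pre} refl p₁ i o p₂)) =
    contradiction (leaf _ _ (~-sym i) o) (Unique-++⇒≢ pre u (last∈ p₁) (there (first∈ p₂)))

  three-leaves⇒untraceable : ∀ u v w → u ≢ v → u ≢ w → v ≢ w → Leaf u → Leaf v → Leaf w → ¬ Traceable G
  three-leaves⇒untraceable u v w u≢v u≢w v≢w _ _ _ ([] , _ , _ , covers) = contradiction (covers u) (λ ())
  three-leaves⇒untraceable u v w u≢v u≢w v≢w lu lv lw (_ ∷ _ , linked , uniq , covers)
    with linked⇒path linked
  ... | b , p with leaf-at-end p uniq (covers u) lu | leaf-at-end p uniq (covers v) lv | leaf-at-end p uniq (covers w) lw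
  ...   | inj₁ refl | inj₁ refl | _         = u≢v refl
  ...   | inj₂ refl | inj₂ refl | _         = u≢v refl
  ...   | inj₁ refl | _         | inj₁ refl = u≢w refl
  ...   | inj₂ refl | _         | inj₂ refl = u≢w refl
  ...   | _         | inj₁ refl | inj₁ refl = v≢w refl
  ...   | _         | inj₂ refl | inj₂ refl = v≢w refl

  -- Both examples have radius two, so connectedness reduces to this finite check.
  NearTo : Fin n → Set
  NearTo r = ∀ v → v ≡ r ⊎ v ~ r ⊎ (∃[ c ] v ~ c × c ~ r)

  nearTo? : ∀ r → Dec (NearTo r)
  nearTo? r = Fin.all? λ v → (v Fin.≟ r) ⊎-dec (v ~? r) ⊎-dec (Fin.any? λ c → (v ~? c) ×-dec (c ~? r))

  NearTo⇒connected : ∀ r → NearTo r → Connected G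
  NearTo⇒connected r near u v with near u | near v
  ... | to | from = toRoot to (fromRoot from)
    where
    toRoot : ∀ {u v} → u ≡ r ⊎ u ~ r ⊎ (∃[ c ] u ~ c × c ~ r) → Reach G r v → Reach G u v
    toRoot (inj₁ refl) q = q
    toRoot (inj₂ (inj₁ e)) q = step e q
    toRoot (inj₂ (inj₂ (c , e , e′))) q = step e (step e′ q)
    fromRoot : ∀ {v} → v ≡ r ⊎ v ~ r ⊎ (∃[ c ] v ~ c × c ~ r) → Reach G r v
    fromRoot (inj₁ refl) = here
    fromRoot (inj₂ (inj₁ e)) = step (~-sym e) here
    fromRoot (inj₂ (inj₂ (c , e , e′))) = step (~-sym e′) (step (~-sym e) here)

  -- As `p`, `q`, `r` run through all orders, every two leaves of every claw must form a heavy pair.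
  -- Premises are interleaved with quantifiers so that the exhaustive check stops early.
  ClawCondition : Set
  ClawCondition = ∀ c p → c ~ p → ∀ q → c ~ q → p ≢ q → ¬ (p ~ q) →
    ∀ r → c ~ r → p ≢ r → q ≢ r → ¬ (p ~ r) → ¬ (q ~ r) → Heavy p q

  clawCondition? : Dec ClawCondition
  clawCondition? = Fin.all? λ c → Fin.all? λ p → (c ~? p) →-dec Fin.all? λ q → (c ~? q) →-dec
    ¬? (p Fin.≟ q) →-dec ¬? (p ~? q) →-dec Fin.all? λ r → (c ~? r) →-dec
    ¬? (p Fin.≟ r) →-dec ¬? (q Fin.≟ r) →-dec ¬? (p ~? r) →-dec ¬? (q ~? r) →-dec (n ≤? deg G p + deg G q + 1)

  clawCondition⇒heavy : ClawCondition → ClawO-1Heavy G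
  clawCondition⇒heavy condition f (f-inj , adj-f) = 1F , 2F , (λ ()) , adj-f 1F 2F ,
    condition (f 0F) (f 1F) (adj-f 0F 1F) (f 2F) (adj-f 0F 2F) (f≢ (λ ())) (f≁ (adj-f 1F 2F))
      (f 3F) (adj-f 0F 3F) (f≢ (λ ())) (f≢ (λ ())) (f≁ (adj-f 1F 3F)) (f≁ (adj-f 2F 3F))
    where
    f≢ : ∀ {i j} → i ≢ j → f i ≢ f j
    f≢ i≢j e = i≢j (f-inj e)
    f≁ : ∀ {u v} → adj G u v ≡ false → ¬ (u ~ v)
    f≁ e e′ = contradiction (trans (≡-sym e) e′) (λ ())

  -- A bull with triangle p q r and pendant vertices s at p and t at q violates this implication,
  -- since there p and t are nonadjacent.
  BullPattern : Set
  BullPattern = ∀ p q → p ~ q → ∀ r → p ~ r → q ~ r → ∀ s → p ~ s → ¬ (q ~ s) → ¬ (r ~ s) → ∀ t → q ~ t → ¬ (r ~ t) → p ~ t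

  bullPattern? : Dec BullPattern
  bullPattern? = Fin.all? λ p → Fin.all? λ q → (p ~? q) →-dec Fin.all? λ r → (p ~? r) →-dec (q ~? r) →-dec
    Fin.all? λ s → (p ~? s) →-dec ¬? (q ~? s) →-dec ¬? (r ~? s) →-dec Fin.all? λ t → (q ~? t) →-dec ¬? (r ~? t) →-dec (p ~? t)

bull-absent : ∀ {n} (G : Graph n) → Examples.BullPattern G → Free Bull G
bull-absent G twins (f , _ , adj-f) = contradiction
  (twins (f 0F) (f 1F) (adj-f 0F 1F) (f 2F) (adj-f 0F 2F) (adj-f 1F 2F)
    (f 3F) (adj-f 0F 3F) (≁ (adj-f 1F 3F)) (≁ (adj-f 2F 3F)) (f 4F) (adj-f 1F 4F) (≁ (adj-f 2F 4F)))
  (≁ (adj-f 0F 4F))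
  where
  ≁ : ∀ {u v} → adj G u v ≡ false → ¬ (adj G u v ≡ true)
  ≁ e e′ = contradiction (trans (≡-sym e) e′) (λ ())

Net-connected : Connected Net
Net-connected = NearTo⇒connected 0F (toWitness {a? = nearTo? 0F} tt)
  where open Examples Net

Net-heavy : ClawO-1Heavy Net
Net-heavy = clawCondition⇒heavy (toWitness {a? = clawCondition?} tt)
  where open Examples Net

Net-untraceable : ¬ Traceable Net
Net-untraceable = three-leaves⇒untraceable 3F 4F 5F (λ ()) (λ ()) (λ ())
  (toWitness {a? = leaf? 3F} tt) (toWitness {a? = leaf? 4F} tt) (toWitness {a? = leaf? 5F} tt)
  where open Examples Net

Trident-connected : Connected Trident
Trident-connected = NearTo⇒connected 0F (toWitness {a? = nearTo? 0F} tt)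
  where open Examples Trident

Trident-heavy : ClawO-1Heavy Trident
Trident-heavy = clawCondition⇒heavy (toWitness {a? = clawCondition?} tt)
  where open Examples Trident

Trident-untraceable : ¬ Traceable Trident
Trident-untraceable = three-leaves⇒untraceable 6F 7F 8F (λ ()) (λ ()) (λ ())
  (toWitness {a? = leaf? 6F} tt) (toWitness {a? = leaf? 7F} tt) (toWitness {a? = leaf? 8F} tt)
  where open Examples Trident

Trident-bull-free : Free Bull Trident
Trident-bull-free = bull-absent Trident (toWitness {a? = Examples.bullPattern? Trident} tt)

-- Induced subgraphs of the net

module InNet (m : Subset 6) where

  In : Fin 6 → Set
  In v = lookup m v ≡ true

  in? : ∀ v → Dec (In v)
  in? v = lookup m v Bool.≟ true

  Copy : ∀ {t} → Graph t → Vec (Fin 6) t → Set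
  Copy T h = (∀ i → In (lookup h i)) ×
    (∀ i j → lookup h i ≡ lookup h j → i ≡ j) × (∀ i j → adj Net (lookup h i) (lookup h j) ≡ adj T i j)

  copy? : ∀ {t} (T : Graph t) h → Dec (Copy T h)
  copy? T h = Fin.all? (λ i → in? (lookup h i)) ×-dec
    Fin.all? (λ i → Fin.all? λ j → (lookup h i Fin.≟ lookup h j) →-dec (i Fin.≟ j)) ×-dec
    Fin.all? (λ i → Fin.all? λ j → adj Net (lookup h i) (lookup h j) Bool.≟ adj T i j)

  -- The condition on the size is implied by the rest, but makes the decision below fast.
  Spanned : ∀ {t} → Graph t → Set
  Spanned {t} T = ∣ m ∣ ≡ t × ∃[ h ] Copy T h × (∀ v → In v → ∃[ i ] lookup {n = t} h i ≡ v)

  spanned? : ∀ {t} (T : Graph t) → Dec (Spanned T)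
  spanned? {t} T = (∣ m ∣ ≟ t) ×-dec any-vec? λ h → copy? T h ×-dec Fin.all? λ v → in? v →-dec Fin.any? λ i → lookup h i Fin.≟ v

  -- A certificate of disconnectedness: `p` splits `m` into two nonempty sides with no edge between
  -- them.
  Separated : Set
  Separated = ∃[ p ] (∃[ u ] In u × lookup {n = 6} p u ≡ true) × (∃[ v ] In v × lookup p v ≡ false) ×
    (∀ u v → In u → In v → adj Net u v ≡ true → lookup p u ≡ lookup p v)

  separated? : Dec Separated
  separated? = anySubset? λ p → (Fin.any? λ u → in? u ×-dec (lookup p u Bool.≟ true)) ×-dec
    (Fin.any? λ v → in? v ×-dec (lookup p v Bool.≟ false)) ×-dec
    Fin.all? λ u → Fin.all? λ v → in? u →-dec in? v →-dec (adj Net u v Bool.≟ true) →-dec (lookup p u Bool.≟ lookup p v)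

  AtMostTwo : Set
  AtMostTwo = ∃[ u ] ∃[ v ] ∀ w → In w → w ≡ u ⊎ w ≡ v

  atMostTwo? : Dec AtMostTwo
  atMostTwo? = Fin.any? λ u → Fin.any? λ v → Fin.all? λ w → in? w →-dec ((w Fin.≟ u) ⊎-dec (w Fin.≟ v))

  Classified : Set
  Classified = AtMostTwo ⊎ Separated ⊎ Spanned P3 ⊎ Spanned C3 ⊎ Spanned P4 ⊎ Spanned Z1 ⊎ ∃ (Copy Bull)

  classified? : Dec Classified
  classified? = atMostTwo? ⊎-dec separated? ⊎-dec spanned? P3 ⊎-dec spanned? C3 ⊎-dec spanned? P4 ⊎-dec
    spanned? Z1 ⊎-dec any-vec? (copy? Bull)

-- Exhaustive check of the 64 vertex subsets: a connected induced subgraph of the net on at least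
-- three vertices is one of the four small graphs or contains a bull.
no-unclassified : ¬ (∃[ m ] ¬ InNet.Classified m)
no-unclassified = toWitness {a? = ¬? (anySubset? λ m → ¬? (InNet.classified? m))} tt

classify : ∀ m → InNet.Classified m
classify m = decidable-stable (InNet.classified? m) λ ¬c → no-unclassified (m , ¬c)

-- Transfer of the classification to an embedded graph

witness : ∀ {P : Set} (P? : Dec P) → does P? ≡ true → P
witness (yes p) _ = p

InducedEmb-cong : ∀ {k n} {H : Graph k} {G : Graph n} {f g} → (∀ i → f i ≡ g i) → InducedEmb H G f → InducedEmb H G g
InducedEmb-cong {G = G} f≗g (f-inj , adj-f) =
  (λ e → f-inj (trans (f≗g _) (trans e (≡-sym (f≗g _))))) ,
  (λ i j → trans (cong₂ (adj G) (≡-sym (f≗g i)) (≡-sym (f≗g j))) (adj-f i j))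

-- Vectors replace functions to make the search finite. Decidability allows an embedding into the
-- net to be obtained by contradiction.
embedding? : ∀ {k n} (H : Graph k) (G : Graph n) → Dec (∃ (InducedEmb H G))
embedding? H G = map′ (λ (v , e) → lookup v , e)
  (λ (f , e) → tabulate f , InducedEmb-cong {H = H} {G} (λ i → ≡-sym (lookup∘tabulate f i)) e)
  (any-vec? λ v → map′ (λ inj {i} {j} → inj i j) (λ inj i j → inj)
      (Fin.all? λ i → Fin.all? λ j → (lookup v i Fin.≟ lookup v j) →-dec (i Fin.≟ j))
    ×-dec (Fin.all? λ i → Fin.all? λ j → adj G (lookup v i) (lookup v j) Bool.≟ adj H i j))

module Embedded {k : ℕ} {S : Graph k} {f : Fin k → Fin 6} (f-emb : InducedEmb S Net f) where

  f-inj : ∀ {i j} → f i ≡ f j → i ≡ j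
  f-inj = proj₁ f-emb

  preimage? : ∀ v → Dec (∃[ i ] f i ≡ v)
  preimage? v = Fin.any? λ i → f i Fin.≟ v

  image : Subset 6
  image = tabulate (λ v → does (preimage? v))

  open InNet image

  preimage : ∀ {v} → In v → ∃[ i ] f i ≡ v
  preimage {v} v∈ = witness (preimage? v) (trans (≡-sym (lookup∘tabulate (λ v → does (preimage? v)) v)) v∈)

  f∈image : ∀ i → In (f i)
  f∈image i = trans (lookup∘tabulate (λ v → does (preimage? v)) (f i)) (dec-true (preimage? (f i)) (i , refl))

  copy⇒embedding : ∀ {t} (T : Graph t) h → Copy T h → ∃ (InducedEmb T S)
  copy⇒embedding T h (h∈ , h-inj , adj-h) =
    g , (λ e → h-inj _ _ (trans (≡-sym (fg _)) (trans (cong f e) (fg _)))) ,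
    (λ i j → trans (≡-sym (proj₂ f-emb (g i) (g j))) (trans (cong₂ (adj Net) (fg i) (fg j)) (adj-h i j)))
    where
    g = λ i → proj₁ (preimage {lookup h i} (h∈ i))
    fg : ∀ i → f (g i) ≡ lookup h i
    fg i = proj₂ (preimage {lookup h i} (h∈ i))

  -- Both `S` and `T` are mapped bijectively onto the image, preserving adjacency and nonadjacency;
  -- compose one map with the inverse of the other.
  spanned⇒iso : ∀ {t} (T : Graph t) → Spanned T → Iso S T
  spanned⇒iso T (_ , h , (h∈ , h-inj , adj-h) , onto) = φ , ψ ,
    (λ i → f-inj (trans (fψ (φ i)) (hφ i))) ,
    (λ j → h-inj _ _ (trans (hφ (ψ j)) (fψ j))) ,
    (λ i j → trans (≡-sym (adj-h (φ i) (φ j))) (trans (cong₂ (adj Net) (hφ i) (hφ j)) (proj₂ f-emb i j)))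
    where
    φ = λ i → proj₁ (onto (f i) (f∈image i))
    ψ = λ j → proj₁ (preimage {lookup h j} (h∈ j))
    hφ : ∀ i → lookup h (φ i) ≡ f i
    hφ i = proj₂ (onto (f i) (f∈image i))
    fψ : ∀ j → f (ψ j) ≡ lookup h j
    fψ j = proj₂ (preimage {lookup h j} (h∈ j))

  -- The side is constant along every walk in `S`.
  not-separated : Connected S → ¬ Separated
  not-separated connected (p , (u , u∈ , pu) , (v , v∈ , pv) , closed) with preimage {u} u∈ | preimage {v} v∈
  ... | i , refl | j , refl = contradiction (trans (≡-sym pu) (trans (constant (connected i j)) pv)) (λ ())
    where
    constant : ∀ {i j} → Reach S i j → lookup p (f i) ≡ lookup p (f j)
    constant here = refl
    constant (step {i} {j} e r) =
      trans (closed (f i) (f j) (f∈image i) (f∈image j) (trans (proj₂ f-emb i j) e)) (constant r)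

not-atMostTwo : ∀ {k} {S : Graph k} {f} (f-emb : InducedEmb S Net f) → 3 ≤ k →
  ¬ InNet.AtMostTwo (Embedded.image {S = S} f-emb)
not-atMostTwo {S = S} {f} f-emb (s≤s (s≤s (s≤s _))) (u , v , only) =
  pigeon (only _ (f∈image 0F)) (only _ (f∈image 1F)) (only _ (f∈image 2F))
  where
  open Embedded {S = S} f-emb
  clash : ∀ {i j w} → i ≢ j → f i ≡ w → f j ≡ w → ⊥
  clash i≢j e e′ = i≢j (f-inj (trans e (≡-sym e′)))
  pigeon : f 0F ≡ u ⊎ f 0F ≡ v → f 1F ≡ u ⊎ f 1F ≡ v → f 2F ≡ u ⊎ f 2F ≡ v → ⊥
  pigeon (inj₁ e) (inj₁ e′) _ = clash (λ ()) e e′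
  pigeon (inj₂ e) (inj₂ e′) _ = clash (λ ()) e e′
  pigeon (inj₁ e) _ (inj₁ e′) = clash (λ ()) e e′
  pigeon (inj₂ e) _ (inj₂ e′) = clash (λ ()) e e′
  pigeon _ (inj₁ e) (inj₁ e′) = clash (λ ()) e e′
  pigeon _ (inj₂ e) (inj₂ e′) = clash (λ ()) e e′

Free-mono : ∀ {t k n} {T : Graph t} {S : Graph k} {G : Graph n} → ∃ (InducedEmb T S) → Free T G → Free S G
Free-mono (h , h-inj , adj-h) free (f , f-inj , adj-f) =
  free ((λ i → f (h i)) , (λ e → h-inj (f-inj e)) , (λ i j → trans (adj-f (h i) (h j)) (adj-h i j)))

-- The characterization

theorem9 : (k : ℕ) (S : Graph k) → Connected S → 3 ≤ k → ¬ Iso S P3 →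
    ((∀ (n : ℕ) (G : Graph n) → Connected G → ClawO-1Heavy G → Free S G → Traceable G)
    ⇔ (Iso S C3 ⊎ (Iso S Z1 ⊎ Iso S P4)))
theorem9 k S S-connected 3≤k S≇P3 = mk⇔ necessary sufficient
  where
  necessary : (∀ (n : ℕ) (G : Graph n) → Connected G → ClawO-1Heavy G → Free S G → Traceable G) →
    Iso S C3 ⊎ (Iso S Z1 ⊎ Iso S P4)
  -- If the net were `S`-free, the statement would make it traceable; so `S` embeds in the net.
  necessary forces with decidable-stable (embedding? S Net)
    (λ free → Net-untraceable (forces 6 Net Net-connected Net-heavy free))
  ... | f , f-emb = go (classify (Embedded.image {S = S} f-emb))
    where
    open Embedded {S = S} f-emb
    go : InNet.Classified image → Iso S C3 ⊎ (Iso S Z1 ⊎ Iso S P4)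
    go (inj₁ small) = contradiction small (not-atMostTwo {S = S} f-emb 3≤k)
    go (inj₂ (inj₁ sep)) = contradiction sep (not-separated S-connected)
    go (inj₂ (inj₂ (inj₁ p3))) = contradiction (spanned⇒iso P3 p3) S≇P3
    go (inj₂ (inj₂ (inj₂ (inj₁ c3)))) = inj₁ (spanned⇒iso C3 c3)
    go (inj₂ (inj₂ (inj₂ (inj₂ (inj₁ p4))))) = inj₂ (inj₂ (spanned⇒iso P4 p4))
    go (inj₂ (inj₂ (inj₂ (inj₂ (inj₂ (inj₁ z1)))))) = inj₂ (inj₁ (spanned⇒iso Z1 z1))
    -- If `S` contains a bull, the bull-free `Trident` is `S`-free and would be traceable.
    go (inj₂ (inj₂ (inj₂ (inj₂ (inj₂ (inj₂ (h , bull))))))) = contradiction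
      (forces 9 Trident Trident-connected Trident-heavy
        (Free-mono {T = Bull} {S = S} {G = Trident} (copy⇒embedding Bull h bull) Trident-bull-free))
      Trident-untraceable

  sufficient : Iso S C3 ⊎ (Iso S Z1 ⊎ Iso S P4) →
    ∀ (n : ℕ) (G : Graph n) → Connected G → ClawO-1Heavy G → Free S G → Traceable G
  sufficient (inj₁ iso) n G connected heavy free = Z1-free⇒traceable G connected heavy
    (C3-free⇒Z1-free {G = G} (Free-iso {S = S} {C3} {G} iso free))
  sufficient (inj₂ (inj₁ iso)) n G connected heavy free =
    Z1-free⇒traceable G connected heavy (Free-iso {S = S} {Z1} {G} iso free)
  sufficient (inj₂ (inj₂ iso)) n G connected heavy free =
    P4-free⇒traceable G connected heavy (Free-iso {S = S} {P4} {G} iso free)
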